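{- Let $G$ be a bridgeless cubic graph and let $H\subseteq G$ be an (induced) subgraph with $|\delta_G(H)|=6$. Then either $H$ has a perfect matching, or $H$ contains an independent set $S$ of vertices, each of valency $3$ in $H$, such that (i) every component of $H-S$ has an odd number of vertices, (ii) the number of components of $H-S$ with an odd number of vertices equals $|S|+2$, and (iii) $|\delta_G(L)|=3$ for each component $L$ of $H-S$.
   Context: Graphs may have multiple edges and loops. For a subgraph $H$ of $G$, $\delta_G(H)$ denotes the set of edges of $G$ with exactly one end in $V(H)$. -}

module Defs where

open import Data.Bool.Base using (_∨_; _xor_)
open import Data.Bool.Properties using (∨-zeroʳ)
open import Data.Fin.Base using (Fin)
open import Data.Fin.Properties using (_≟_)
open import Data.Fin.Subset
  using (Subset; outside; _∈_; _∉_; _⊆_; _∩_; _─_; _-_; ⊤; ∣_∣; Nonempty)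
open import Data.Fin.Subset.Properties
  using (_∈?_; ∈⊤; p─q⊆p; x∈p∧x∉q⇒x∈p─q)
open import Data.List.Base using (List; length)
open import Data.List.Membership.Propositional renaming (_∈_ to _∈ₗ_) using ()
open import Data.List.Relation.Unary.Unique.Propositional using (Unique)
open import Data.Nat.Base using (ℕ; _+_; _%_)
open import Data.Product.Base using (Σ; ∃; _×_; _,_; proj₁; proj₂)
open import Data.Sum.Base using (_⊎_)
open import Data.Vec.Base using (tabulate; lookup; _∷_; here; there)
open import Data.Vec.Properties using (lookup⇒[]=; []=⇒lookup; lookup∘tabulate)
open import Function.Bundles using (_⇔_)
open import Relation.Binary.Construct.Closure.ReflexiveTransitive using (Star)
open import Relation.Binary.PropositionalEquality
open import Relation.Nullary using (¬_; does; recompute)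
open import Relation.Nullary.Decidable using (_×-dec_)

-- Finite undirected graphs with loops and multiple edges.  The order of the
-- two ends of an edge is a representation artefact: every notion below is
-- symmetric in `src` and `tgt`.
record Graph : Set where
  field
    nV nE   : ℕ
    src tgt : Fin nE → Fin nV

  Vertex Edge : Set
  Vertex = Fin nV
  Edge   = Fin nE

  VertexSet EdgeSet : Set
  VertexSet = Subset nV
  EdgeSet   = Subset nE

  _IncidentTo_ : Edge → Vertex → Set
  e IncidentTo v = src e ≡ v ⊎ tgt e ≡ v

  Joins : Edge → Vertex → Vertex → Set
  Joins e u v = (src e ≡ u × tgt e ≡ v) ⊎ (src e ≡ v × tgt e ≡ u)

-- The proof field is irrelevant, so that `≡` on subgraphs means having the
-- same vertices and the same edges.
record Subgraph (G : Graph) : Set where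
  constructor mkSubgraph
  open Graph G
  field
    V : VertexSet
    E : EdgeSet
    .closed : ∀ {e} → e ∈ E → src e ∈ V × tgt e ∈ V

open Subgraph public using (V; E)

ends∈V : ∀ {G} (H : Subgraph G) {e} → e ∈ E H →
         Graph.src G e ∈ V H × Graph.tgt G e ∈ V H
ends∈V {G} (mkSubgraph V E c) {e} e∈E =
  recompute ((Graph.src G e ∈? V) ×-dec (Graph.tgt G e ∈? V)) (c e∈E)

module _ {G : Graph} where
  open Graph G

  infix 4 _⊑_

  _⊑_ : Subgraph G → Subgraph G → Set
  H ⊑ K = V H ⊆ V K × E H ⊆ E K

  IsInduced : Subgraph G → Set
  IsInduced H = ∀ e → src e ∈ V H → tgt e ∈ V H → e ∈ E H

  -- A loop contributes 2.
  degree : Subgraph G → Vertex → ℕ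
  degree H v = ∣ E H ∩ tabulate (λ e → does (src e ≟ v)) ∣
             + ∣ E H ∩ tabulate (λ e → does (tgt e ≟ v)) ∣

  δ : Subgraph G → EdgeSet
  δ H = tabulate λ e → lookup (V H) (src e) xor lookup (V H) (tgt e)

  Adjacent : Subgraph G → Vertex → Vertex → Set
  Adjacent H u v = ∃ λ e → e ∈ E H × Joins e u v

  Linked : Subgraph G → Vertex → Vertex → Set
  Linked H = Star (Adjacent H)

  Connected : Subgraph G → Set
  Connected H = Nonempty (V H) ×
                (∀ u v → u ∈ V H → v ∈ V H → Linked H u v)

  IsComponent : Subgraph G → Subgraph G → Set
  IsComponent K L =
    Connected L × L ⊑ K ×
    (∀ L′ → Connected L′ → L′ ⊑ K → L ⊑ L′ → L′ ≡ L)

  HasOddOrder : Subgraph G → Set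
  HasOddOrder L = ∣ V L ∣ % 2 ≡ 1

  Independent : Subgraph G → VertexSet → Set
  Independent H S = ∀ e → e ∈ E H → ¬ (src e ∈ S × tgt e ∈ S)

  IsMatching : Subgraph G → EdgeSet → Set
  IsMatching H M =
    M ⊆ E H ×
    (∀ e → e ∈ M → src e ≢ tgt e) ×
    (∀ e f v → e ∈ M → f ∈ M → e IncidentTo v → f IncidentTo v → e ≡ f)

  IsPerfectMatching : Subgraph G → EdgeSet → Set
  IsPerfectMatching H M =
    IsMatching H M × (∀ v → v ∈ V H → ∃ λ e → e ∈ M × e IncidentTo v)

  HasPerfectMatching : Subgraph G → Set
  HasPerfectMatching H = ∃ (IsPerfectMatching H)

  NumberOfSubgraphs : (Subgraph G → Set) → ℕ → Set
  NumberOfSubgraphs P k =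
    Σ (List (Subgraph G)) λ Ls →
      Unique Ls × (∀ L → L ∈ₗ Ls ⇔ P L) × length Ls ≡ k

  meeting : VertexSet → EdgeSet
  meeting S = tabulate λ e → lookup S (src e) ∨ lookup S (tgt e)

  private
    ∈─⇒∉ : ∀ {n} {p q : Subset n} {x} → x ∈ p ─ q → x ∉ q
    ∈─⇒∉ {p = _ ∷ _} {outside ∷ _} here       ()
    ∈─⇒∉ {p = _ ∷ _} {_ ∷ _}       (there x∈) (there x∈q) = ∈─⇒∉ x∈ x∈q

    src∈⇒meeting : ∀ {S e} → src e ∈ S → e ∈ meeting S
    src∈⇒meeting {S} {e} s∈ = lookup⇒[]= e _
      (trans (lookup∘tabulate _ e) (cong (_∨ lookup S (tgt e)) ([]=⇒lookup s∈)))

    tgt∈⇒meeting : ∀ {S e} → tgt e ∈ S → e ∈ meeting S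
    tgt∈⇒meeting {S} {e} t∈ = lookup⇒[]= e _
      (trans (lookup∘tabulate _ e)
        (trans (cong (lookup S (src e) ∨_) ([]=⇒lookup t∈)) (∨-zeroʳ _)))

  infixl 5 _∖_ _∖ₑ_

  _∖_ : Subgraph G → VertexSet → Subgraph G
  H ∖ S = mkSubgraph (V H ─ S) (E H ─ meeting S) λ e∈ →
    let (s , t) = ends∈V H (p─q⊆p (E H) _ e∈) in
      x∈p∧x∉q⇒x∈p─q s (λ s∈S → ∈─⇒∉ e∈ (src∈⇒meeting s∈S))
    , x∈p∧x∉q⇒x∈p─q t (λ t∈S → ∈─⇒∉ e∈ (tgt∈⇒meeting {S} t∈S))

  _∖ₑ_ : Subgraph G → Edge → Subgraph G
  H ∖ₑ e = mkSubgraph (V H) (E H - e) λ f∈ → ends∈V H (p─q⊆p (E H) _ f∈)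

whole : (G : Graph) → Subgraph G
whole G = mkSubgraph ⊤ ⊤ λ _ → ∈⊤ , ∈⊤

Cubic : Graph → Set
Cubic G = ∀ v → degree (whole G) v ≡ 3

IsBridge : (G : Graph) → Graph.Edge G → Set
IsBridge G e = ¬ Linked (whole G ∖ₑ e) (Graph.src G e) (Graph.tgt G e)

Bridgeless : Graph → Set
Bridgeless G = ¬ ∃ (IsBridge G)

{-# OPTIONS --safe #-}

module Submission where

-- Among the sets S for which every matching of H ∖ S misses at least |S| + d
-- vertices, d being the deficiency of H, take a maximal one.  Then every vertex
-- of H ∖ S is missed by some maximum matching of H ∖ S, so (Gallai) no maximum
-- matching misses two vertices of one component; hence all components are odd
-- and there are |S| + d of them.  By parity and bridgelessness d ≥ 2 and each
-- component sends out at least 3 edges, while S and δ(H) can absorb at most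
-- 3|S| + 6; so d = 2 and all these inequalities are equalities.

open import Defs
open import Data.Bool.Base using (Bool; true; false; _∧_; _∨_; _xor_; not)
open import Data.Fin.Base using (Fin; zero; suc; toℕ) renaming (_<_ to _<ᶠ_)
open import Data.Fin.Permutation using (permutation)
open import Data.Fin.Properties using (_≟_; any?; all?) renaming (_<?_ to _<ᶠ?_; <-cmp to <ᶠ-cmp)
open import Data.Fin.Subset
open import Data.Fin.Subset.Properties
open import Data.List.Base as List using (List; filter; allFin)
open import Data.List.Membership.Propositional renaming (_∈_ to _∈ₗ_) using ()
open import Data.List.Membership.Propositional.Properties
  using (∈-map⁺; ∈-map⁻; ∈-filter⁺; ∈-filter⁻; ∈-allFin)
open import Data.List.Properties using (length-map)
import Data.List.Relation.Unary.All as All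
import Data.List.Relation.Unary.All.Properties as All
open import Data.List.Relation.Unary.AllPairs using ([]; _∷_)
open import Data.List.Relation.Unary.Any using (here; there)
open import Data.List.Relation.Unary.Unique.Propositional using (Unique)
open import Data.List.Relation.Unary.Unique.Propositional.Properties using (filter⁺; allFin⁺)
open import Data.Maybe.Base using (Maybe; just; nothing)
open import Data.Maybe.Properties using (≡-dec; just-injective)
open import Data.Nat.Base using (ℕ; zero; suc; _+_; _*_; _%_; _≤_; _<_; parity; s≤s; z≤n)
open import Data.Nat.Induction using (<-wellFounded)
open import Data.Nat.Properties as ℕ using (+-*-semiring)
open import Data.Parity.Base as ℙ using (0ℙ; 1ℙ)
open import Data.Parity.Properties as ℙ using (+-homo-+)
open import Data.Product.Base using (∃; _×_; _,_; proj₁; proj₂)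
open import Data.Sum.Base using (_⊎_; inj₁; inj₂; swap)
open import Data.Vec.Base using (Vec; []; _∷_; tabulate; lookup; here; there; _[_]≔_)
open import Data.Vec.Properties
  using (lookup∘tabulate; lookup⇒[]=; []=⇒lookup; lookup-zipWith; lookup∘update; lookup∘update′)
open import Function.Base using (_∘_; id)
open import Function.Bundles using (mk⇔)
open import Induction.WellFounded using (Acc; acc)
open import Relation.Binary.Construct.Closure.ReflexiveTransitive using (ε; _◅_; _◅◅_; reverse)
open import Relation.Binary.Definitions using (tri<; tri≈; tri>)
open import Relation.Binary.PropositionalEquality
open import Relation.Nullary using (Dec; yes; no; does; ¬_; contradiction)
open import Relation.Nullary.Decidable
  using (_×-dec_; _⊎-dec_; _→-dec_; ¬?; map′; dec-true; dec-false; decidable-stable)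
open import Relation.Unary using (Decidable)
open import Algebra.Properties.Semiring.Sum +-*-semiring

-- No min-max formula is invoked: the condition on S speaks of matchings only, the empty set
-- satisfies it by the choice of d, and components enter only once S is fixed. Matchings are
-- involutions of the vertex set, so parallel edges are invisible to the matching theory, and
-- exhaustive search decides both the choice of an optimal matching and whether S can be enlarged by
-- a vertex. The bound 3|S| + 6 counts the edge ends in S together with the edges of δ(H), and every
-- edge leaving a component uses up at least one of these units. Equality is exploited edge by edge:
-- an edge inside S, or from S to the outside of H, would take two units and leave no component. Its
-- absence gives both the independence of S and the valency 3.

private variable
  n k : ℕ

-- Cardinalities, indicator sums and parity

χ : Bool → ℕ
χ true  = 1
χ false = 0

∣p∣≡∑χ : (p : Subset n) → ∣ p ∣ ≡ ∑[ i < n ] χ (lookup p i)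
∣p∣≡∑χ []            = refl
∣p∣≡∑χ (outside ∷ p) = ∣p∣≡∑χ p
∣p∣≡∑χ (inside ∷ p)  = cong suc (∣p∣≡∑χ p)

∣tabulate∣≡∑χ : (f : Fin n → Bool) → ∣ tabulate f ∣ ≡ ∑[ i < n ] χ (f i)
∣tabulate∣≡∑χ {n} f = trans (∣p∣≡∑χ (tabulate f)) (sum-cong-≗ λ i → cong χ (lookup∘tabulate f i))

Empty⇒∣p∣≡0 : {p : Subset n} → Empty p → ∣ p ∣ ≡ 0
Empty⇒∣p∣≡0 {n} {p} empty = trans (cong ∣_∣ (Empty-unique {p = p} empty)) (∣⊥∣≡0 n)

⟦_⟧ : {P : Fin n → Set} → Decidable P → Subset n
⟦ P? ⟧ = tabulate (does ∘ P?)

module _ {P : Fin n → Set} (P? : Decidable P) where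

  ∈⟦⟧⁺ : ∀ {i} → P i → i ∈ ⟦ P? ⟧
  ∈⟦⟧⁺ {i} Pi = lookup⇒[]= i _ (trans (lookup∘tabulate _ i) (dec-true (P? i) Pi))

  ∈⟦⟧⁻ : ∀ {i} → i ∈ ⟦ P? ⟧ → P i
  ∈⟦⟧⁻ {i} i∈ with P? i | trans (sym (lookup∘tabulate (does ∘ P?) i)) ([]=⇒lookup i∈)
  ... | yes Pi | _  = Pi
  ... | no  _  | ()

∣p∪⁅x⁆∣ : {p : Subset n} {x : Fin n} → x ∉ p → ∣ p ∪ ⁅ x ⁆ ∣ ≡ suc ∣ p ∣
∣p∪⁅x⁆∣ {p = inside ∷ p}  {zero}  x∉p = contradiction here x∉p
∣p∪⁅x⁆∣ {p = outside ∷ p} {zero}  x∉p = cong (suc ∘ ∣_∣) (∪-identityʳ p)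
∣p∪⁅x⁆∣ {p = inside ∷ p}  {suc x} x∉p = cong suc (∣p∪⁅x⁆∣ (x∉p ∘ there))
∣p∪⁅x⁆∣ {p = outside ∷ p} {suc x} x∉p = ∣p∪⁅x⁆∣ (x∉p ∘ there)

x∈p⇒∣p∣≡1+∣p-x∣ : {p : Subset n} {x : Fin n} → x ∈ p → ∣ p ∣ ≡ suc ∣ p - x ∣
x∈p⇒∣p∣≡1+∣p-x∣ {p = _ ∷ p}       {zero}  here        = cong (suc ∘ ∣_∣) (sym (p─⊥≡p p))
x∈p⇒∣p∣≡1+∣p-x∣ {p = inside ∷ p}  {suc x} (there x∈p) = cong suc (x∈p⇒∣p∣≡1+∣p-x∣ x∈p)
x∈p⇒∣p∣≡1+∣p-x∣ {p = outside ∷ p} {suc x} (there x∈p) = x∈p⇒∣p∣≡1+∣p-x∣ x∈p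

p⊆q⇒∣q─p∣+∣p∣≡∣q∣ : {p q : Subset n} → p ⊆ q → ∣ q ─ p ∣ + ∣ p ∣ ≡ ∣ q ∣
p⊆q⇒∣q─p∣+∣p∣≡∣q∣ {p = []}          {[]}          p⊆q = refl
p⊆q⇒∣q─p∣+∣p∣≡∣q∣ {p = outside ∷ p} {outside ∷ q} p⊆q = p⊆q⇒∣q─p∣+∣p∣≡∣q∣ (drop-∷-⊆ p⊆q)
p⊆q⇒∣q─p∣+∣p∣≡∣q∣ {p = outside ∷ p} {inside ∷ q}  p⊆q = cong suc (p⊆q⇒∣q─p∣+∣p∣≡∣q∣ (drop-∷-⊆ p⊆q))
p⊆q⇒∣q─p∣+∣p∣≡∣q∣ {p = inside ∷ p}  {outside ∷ q} p⊆q = contradiction (p⊆q here) λ()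
p⊆q⇒∣q─p∣+∣p∣≡∣q∣ {p = inside ∷ p}  {inside ∷ q}  p⊆q =
  trans (ℕ.+-suc _ _) (cong suc (p⊆q⇒∣q─p∣+∣p∣≡∣q∣ (drop-∷-⊆ p⊆q)))

x∈p─q⇒x∉q : {p q : Subset n} {x : Fin n} → x ∈ p ─ q → x ∉ q
x∈p─q⇒x∉q {p = _ ∷ _} {outside ∷ _} here       ()
x∈p─q⇒x∉q {p = _ ∷ _} {_ ∷ _}       (there x∈) (there x∈q) = x∈p─q⇒x∉q x∈ x∈q

x∉p-x : {p : Subset n} {x : Fin n} → x ∉ p - x
x∉p-x x∈ = x∈p─q⇒x∉q x∈ (x∈⁅x⁆ _)

x∈p-y⇒x≢y : {p : Subset n} {x y : Fin n} → x ∈ p - y → x ≢ y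
x∈p-y⇒x≢y x∈ refl = x∉p-x x∈

n+n-even : ∀ n → parity (n + n) ≡ 0ℙ
n+n-even n = trans (+-homo-+ n n) (ℙ.p+p≡0ℙ (parity n))

parity-suc-≢ : ∀ n → parity (suc n) ≢ parity n
parity-suc-≢ n eq = ℙ.p≢p⁻¹ (parity (suc n)) (trans eq (sym (ℙ.suc-homo-⁻¹ n)))

parity-swap : ∀ {a b c} → parity (a + b) ≡ parity c → parity a ≡ parity (b + c)
parity-swap {a} {b} {c} eq = begin
  parity a                              ≡⟨ ℙ.+-identityʳ _ ⟨
  parity a ℙ.+ 0ℙ                       ≡⟨ cong (parity a ℙ.+_) (n+n-even b) ⟨
  parity a ℙ.+ parity (b + b)           ≡⟨ +-homo-+ a (b + b) ⟨
  parity (a + (b + b))                  ≡⟨ cong parity (ℕ.+-assoc a b b) ⟨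
  parity (a + b + b)                    ≡⟨ +-homo-+ (a + b) b ⟩
  parity (a + b) ℙ.+ parity b           ≡⟨ cong (ℙ._+ parity b) eq ⟩
  parity c ℙ.+ parity b                 ≡⟨ ℙ.+-comm (parity c) _ ⟩
  parity b ℙ.+ parity c                 ≡⟨ +-homo-+ b c ⟨
  parity (b + c)                        ∎
  where open ≡-Reasoning

fixed : (Fin n → Fin n) → Subset n
fixed f = ⟦ (λ v → f v ≟ v) ⟧

-- The points of p moved by f are paired up by f, so those with v < f v and
-- those with f v < v are equinumerous.
parity-fixed : (p : Subset n) {f : Fin n → Fin n} → (∀ v → f (f v) ≡ v) →
               (∀ {v} → v ∈ p → f v ∈ p) → parity ∣ p ∩ fixed f ∣ ≡ parity ∣ p ∣
parity-fixed {n} p {f} invol closed = sym (begin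
  parity ∣ p ∣                                    ≡⟨ cong parity split ⟩
  parity (∣ p ∩ fixed f ∣ + (sum up + sum up))    ≡⟨ +-homo-+ ∣ p ∩ fixed f ∣ _ ⟩
  parity ∣ p ∩ fixed f ∣ ℙ.+ parity (sum up + sum up)
    ≡⟨ cong (parity ∣ p ∩ fixed f ∣ ℙ.+_) (n+n-even (sum up)) ⟩
  parity ∣ p ∩ fixed f ∣ ℙ.+ 0ℙ                   ≡⟨ ℙ.+-identityʳ _ ⟩
  parity ∣ p ∩ fixed f ∣                          ∎)
  where
  open ≡-Reasoning
  fix up down : Fin n → ℕ
  fix v = χ (lookup (p ∩ fixed f) v)
  up v = χ (lookup p v ∧ does (v <ᶠ? f v))
  down v = χ (lookup p v ∧ does (f v <ᶠ? v))

  lookup-f : ∀ v → lookup p (f v) ≡ lookup p v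
  lookup-f v with v ∈? p | f v ∈? p
  ... | yes v∈ | _       = trans ([]=⇒lookup (closed v∈)) (sym ([]=⇒lookup v∈))
  ... | no v∉  | yes fv∈ = contradiction (subst (_∈ p) (invol v) (closed fv∈)) v∉
  ... | no v∉  | no fv∉  = trans (¬-not fv∉) (sym (¬-not v∉))
    where
    ¬-not : ∀ {w} → w ∉ p → lookup p w ≡ false
    ¬-not {w} w∉ with lookup p w in eq
    ... | true  = contradiction (lookup⇒[]= w p eq) w∉
    ... | false = refl

  down≡up∘f : ∀ v → down v ≡ up (f v)
  down≡up∘f v rewrite lookup-f v | invol v = refl

  sum-down : sum down ≡ sum up
  sum-down = trans (sum-cong-≗ down≡up∘f) (sym (sum-permute up (permutation f f invol invol)))

  pointwise : ∀ v → χ (lookup p v) ≡ fix v + (up v + down v)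
  pointwise v rewrite lookup-zipWith _∧_ v p (fixed f) | lookup∘tabulate (λ u → does (f u ≟ u)) v
    with lookup p v | <ᶠ-cmp v (f v)
  ... | false | _ = refl
  ... | true  | tri< a b c
    rewrite dec-false (f v ≟ v) (b ∘ sym) | dec-true (v <ᶠ? f v) a | dec-false (f v <ᶠ? v) c = refl
  ... | true  | tri≈ a b c
    rewrite dec-true (f v ≟ v) (sym b) | dec-false (v <ᶠ? f v) a | dec-false (f v <ᶠ? v) c = refl
  ... | true  | tri> a b c
    rewrite dec-false (f v ≟ v) (b ∘ sym) | dec-false (v <ᶠ? f v) a | dec-true (f v <ᶠ? v) c = refl

  split : ∣ p ∣ ≡ ∣ p ∩ fixed f ∣ + (sum up + sum up)
  split = begin
    ∣ p ∣                                      ≡⟨ ∣p∣≡∑χ p ⟩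
    ∑[ v < n ] χ (lookup p v)                  ≡⟨ sum-cong-≗ pointwise ⟩
    ∑[ v < n ] (fix v + (up v + down v))       ≡⟨ ∑-distrib-+ fix _ ⟩
    sum fix + ∑[ v < n ] (up v + down v)       ≡⟨ cong (sum fix +_) (∑-distrib-+ up down) ⟩
    sum fix + (sum up + sum down)
      ≡⟨ cong₂ (λ a b → a + (sum up + b)) (sym (∣p∣≡∑χ (p ∩ fixed f))) sum-down ⟩
    ∣ p ∩ fixed f ∣ + (sum up + sum up)        ∎

-- Exhaustive search, and rematching one vertex

-- Matchings are encoded as vectors of partners, so this decides whether a matching with a given
-- decidable property exists.
anyVec? : {P : Vec (Fin n) k → Set} → Decidable P → Dec (∃ P)
anyVec? {k = zero} P? = map′ (λ Pe → [] , Pe) (λ { ([] , Pe) → Pe }) (P? [])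
anyVec? {k = suc k} P? =
  map′ (λ (x , xs , Pxs) → x ∷ xs , Pxs) (λ { (x ∷ xs , Pxs) → x , xs , Pxs })
       (any? λ x → anyVec? λ xs → P? (x ∷ xs))

argmin : {P : Vec (Fin n) k → Set} → Decidable P → (f : Vec (Fin n) k → ℕ) → ∃ P →
         ∃ λ m → P m × (∀ m′ → P m′ → f m ≤ f m′)
argmin {P = P} P? f (m , Pm) = search m Pm (<-wellFounded _)
  where
  search : ∀ m → P m → Acc _<_ (f m) → ∃ λ m → P m × (∀ m′ → P m′ → f m ≤ f m′)
  search m Pm (acc rec) with anyVec? (λ m′ → P? m′ ×-dec (f m′ ℕ.<? f m))
  ... | yes (m′ , Pm′ , lt) = search m′ Pm′ (rec lt)
  ... | no none = m , Pm , λ m′ Pm′ → ℕ.≮⇒≥ λ lt → none (m′ , Pm′ , lt)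

-- If y is fixed by m, the first update is overwritten by the last.
rematch : Vec (Fin n) n → Fin n → Fin n → Vec (Fin n) n
rematch m x y = m [ lookup m y ]≔ lookup m y [ x ]≔ y [ y ]≔ x

module _ (m : Vec (Fin n) n) {x y : Fin n} (x≢y : x ≢ y) where

  private
    z = lookup m y
    m₁ = m [ z ]≔ z
    m₂ = m₁ [ x ]≔ y
    m′ = lookup (rematch m x y)

  -- Later updates overwrite earlier ones, so `at-z` excludes x and y. If y is unmatched then z ≡ y,
  -- and `at-z` never occurs.
  data Rematched (v : Fin n) : Set where
    at-x : v ≡ x → m′ v ≡ y → Rematched v
    at-y : v ≡ y → m′ v ≡ x → Rematched v
    at-z : v ≢ x → v ≢ y → v ≡ z → m′ v ≡ v → Rematched v
    else : v ≢ x → v ≢ y → v ≢ z → m′ v ≡ lookup m v → Rematched v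

  rematched : ∀ v → Rematched v
  rematched v with v ≟ y | v ≟ x | v ≟ z
  ... | yes refl | _        | _        = at-y refl (lookup∘update y m₂ x)
  ... | no v≢y   | yes refl | _        = at-x refl
    (trans (lookup∘update′ v≢y m₂ x) (lookup∘update x m₁ y))
  ... | no v≢y   | no v≢x   | yes refl = at-z v≢x v≢y refl
    (trans (lookup∘update′ v≢y m₂ x) (trans (lookup∘update′ v≢x m₁ y) (lookup∘update z m z)))
  ... | no v≢y   | no v≢x   | no v≢z   = else v≢x v≢y v≢z
    (trans (lookup∘update′ v≢y m₂ x) (trans (lookup∘update′ v≢x m₁ y) (lookup∘update′ v≢z m z)))

-- Matchings as involutions

module Matching {n} {Adj : Fin n → Fin n → Set} (Adj? : ∀ u v → Dec (Adj u v))
                (Adj-sym : ∀ {u v} → Adj u v → Adj v u) where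

  -- A matching of the graph induced on Y, given by the involution that swaps
  -- matched vertices and fixes all others.
  record IsMatchingOn (Y : Subset n) (m : Vec (Fin n) n) : Set where
    constructor matching
    field
      invol : ∀ v → lookup m (lookup m v) ≡ v
      edge  : ∀ v → lookup m v ≢ v → v ∈ Y × Adj v (lookup m v)

  open IsMatchingOn public

  isMatchingOn? : ∀ Y → Decidable (IsMatchingOn Y)
  isMatchingOn? Y m = map′ (λ (i , e) → matching i e) (λ M → invol M , edge M)
    (all? (λ v → lookup m (lookup m v) ≟ v) ×-dec
     all? (λ v → ¬? (lookup m v ≟ v) →-dec ((v ∈? Y) ×-dec Adj? v (lookup m v))))

  missed : Subset n → Vec (Fin n) n → Subset n
  missed Y m = Y ∩ fixed (lookup m)

  ∈missed⁺ : ∀ {Y} m {v} → v ∈ Y → lookup m v ≡ v → v ∈ missed Y m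
  ∈missed⁺ m v∈Y mv≡v = x∈p∩q⁺ (v∈Y , ∈⟦⟧⁺ (λ u → lookup m u ≟ u) mv≡v)

  ∈missed⁻ : ∀ {Y} m {v} → v ∈ missed Y m → v ∈ Y × lookup m v ≡ v
  ∈missed⁻ {Y} m v∈ = let (v∈Y , v∈F) = x∈p∩q⁻ Y _ v∈ in v∈Y , ∈⟦⟧⁻ (λ u → lookup m u ≟ u) v∈F

  -- `edge` places only the moved vertex itself in Y, but the partner of a moved vertex is moved
  -- too, because m is an involution.
  mate∈ : ∀ {Y m v} → IsMatchingOn Y m → lookup m v ≢ v → lookup m v ∈ Y
  mate∈ {v = v} M mv≢v = proj₁ (edge M _ λ eq → mv≢v (trans (sym eq) (invol M v)))

  mate∈′ : ∀ {Y m v} → IsMatchingOn Y m → v ∈ Y → lookup m v ∈ Y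
  mate∈′ {Y} {m} {v} M v∈Y with lookup m v ≟ v
  ... | yes mv≡v = subst (_∈ Y) (sym mv≡v) v∈Y
  ... | no mv≢v  = mate∈ M mv≢v

  IsMatchingOn-⊆ : ∀ {Y Z m} → Y ⊆ Z → IsMatchingOn Y m → IsMatchingOn Z m
  IsMatchingOn-⊆ Y⊆Z M = matching (invol M) λ v mv≢v → let (v∈ , a) = edge M v mv≢v in Y⊆Z v∈ , a

  trivial : ∀ Y → IsMatchingOn Y (tabulate id)
  trivial Y = matching (λ v → trans (id≗ _) (id≗ v)) λ v v≢v → contradiction (id≗ v) v≢v
    where
    id≗ : ∀ v → lookup (tabulate id) v ≡ v
    id≗ = lookup∘tabulate id

  parity-missed : ∀ {Y m} → IsMatchingOn Y m → parity ∣ missed Y m ∣ ≡ parity ∣ Y ∣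
  parity-missed M = parity-fixed _ (invol M) (mate∈′ M)

  module _ {Y m x y} (M : IsMatchingOn Y m) (x∈Y : x ∈ Y) (y∈Y : y ∈ Y)
           (mx≡x : lookup m x ≡ x) (x≢y : x ≢ y) (x~y : Adj x y) where
    private
      z = lookup m y
      m′ = lookup (rematch m x y)

      m-injective : ∀ {u v} → lookup m u ≡ lookup m v → u ≡ v
      m-injective {u} {v} eq = trans (sym (invol M u)) (trans (cong (lookup m) eq) (invol M v))

      m′x : m′ x ≡ y
      m′x with rematched m x≢y x
      ... | at-x _ eq      = eq
      ... | at-y x≡y _     = contradiction x≡y x≢y
      ... | at-z x≢x _ _ _ = contradiction refl x≢x
      ... | else x≢x _ _ _ = contradiction refl x≢x

      m′y : m′ y ≡ x
      m′y with rematched m x≢y y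
      ... | at-x y≡x _     = contradiction (sym y≡x) x≢y
      ... | at-y _ eq      = eq
      ... | at-z _ y≢y _ _ = contradiction refl y≢y
      ... | else _ y≢y _ _ = contradiction refl y≢y

    -- The pair of y and z is broken up, x and y become a pair and z is freed. The partner of any
    -- other vertex is none of x, y, z: m is injective, fixes x, and swaps y with z.
    rematch-isMatching : IsMatchingOn Y (rematch m x y)
    rematch-isMatching = matching invol′ edge′
      where
      invol′ : ∀ v → m′ (m′ v) ≡ v
      invol′ v with rematched m x≢y v
      ... | at-x refl eq          = trans (cong m′ eq) m′y
      ... | at-y refl eq          = trans (cong m′ eq) m′x
      ... | at-z _ _ _ eq         = trans (cong m′ eq) eq
      ... | else v≢x v≢y v≢z eq with rematched m x≢y (lookup m v)
      ...   | at-x mv≡x _         = contradiction (m-injective (trans mv≡x (sym mx≡x))) v≢x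
      ...   | at-y mv≡y _         = contradiction (trans (sym (invol M v)) (cong (lookup m) mv≡y)) v≢z
      ...   | at-z _ _ mv≡z _     = contradiction (m-injective mv≡z) v≢y
      ...   | else _ _ _ eq′      = trans (cong m′ eq) (trans eq′ (invol M v))

      edge′ : ∀ v → m′ v ≢ v → v ∈ Y × Adj v (m′ v)
      edge′ v m′v≢v with rematched m x≢y v
      ... | at-x refl eq  = x∈Y , subst (Adj x) (sym eq) x~y
      ... | at-y refl eq  = y∈Y , subst (Adj y) (sym eq) (Adj-sym x~y)
      ... | at-z _ _ _ eq = contradiction eq m′v≢v
      ... | else _ _ _ eq =
        let (v∈Y , a) = edge M v (λ mv≡v → m′v≢v (trans eq mv≡v))
        in v∈Y , subst (Adj v) (sym eq) a

    missed-rematch : ∀ {v} → v ∈ missed Y (rematch m x y) →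
                     v ≢ x × v ≢ y × (v ≡ z ⊎ v ∈ missed Y m)
    missed-rematch {v} v∈ with ∈missed⁻ (rematch m x y) v∈ | rematched m x≢y v
    ... | _ , m′v≡v   | at-x refl eq       = contradiction (trans (sym m′v≡v) eq) x≢y
    ... | _ , m′v≡v   | at-y refl eq       = contradiction (trans (sym eq) m′v≡v) x≢y
    ... | _ , _       | at-z v≢x v≢y v≡z _ = v≢x , v≢y , inj₁ v≡z
    ... | v∈Y , m′v≡v | else v≢x v≢y _ eq  =
      v≢x , v≢y , inj₂ (∈missed⁺ m v∈Y (trans (sym eq) m′v≡v))

    -- x is gained and at most z is lost.
    ∣missed-rematch∣ : ∣ missed Y (rematch m x y) ∣ ≤ ∣ missed Y m ∣
    ∣missed-rematch∣ = begin
      ∣ missed Y (rematch m x y) ∣      ≤⟨ p⊆q⇒∣p∣≤∣q∣ sub ⟩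
      ∣ (missed Y m - x) ∪ ⁅ z ⁆ ∣      ≤⟨ ∣p∪⁅x⁆∣≤ ⟩
      suc ∣ missed Y m - x ∣            ≡⟨ x∈p⇒∣p∣≡1+∣p-x∣ (∈missed⁺ m x∈Y mx≡x) ⟨
      ∣ missed Y m ∣                    ∎
      where
      open ℕ.≤-Reasoning
      ∣p∪⁅x⁆∣≤ : ∣ (missed Y m - x) ∪ ⁅ z ⁆ ∣ ≤ suc ∣ missed Y m - x ∣
      ∣p∪⁅x⁆∣≤ with z ∈? missed Y m - x
      ... | no z∉  = ℕ.≤-reflexive (∣p∪⁅x⁆∣ z∉)
      -- This happens when y is unmatched: a missed z satisfies z ≡ m z ≡ y.
      ... | yes z∈ = ℕ.m≤n⇒m≤1+n (p⊆q⇒∣p∣≤∣q∣ λ {w} w∈ → case (x∈p∪q⁻ _ _ w∈))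
        where
        case : ∀ {w} → w ∈ missed Y m - x ⊎ w ∈ ⁅ z ⁆ → w ∈ missed Y m - x
        case (inj₁ w∈) = w∈
        case (inj₂ w∈) = subst (_∈ _) (sym (x∈⁅y⁆⇒x≡y z w∈)) z∈
      sub : missed Y (rematch m x y) ⊆ (missed Y m - x) ∪ ⁅ z ⁆
      sub v∈ with missed-rematch v∈
      ... | _   , _ , inj₁ refl = x∈p∪q⁺ (inj₂ (x∈⁅x⁆ z))
      ... | v≢x , _ , inj₂ v∈m  = x∈p∪q⁺ (inj₁ (x∈p∧x≢y⇒x∈p-y v∈m v≢x))

    -- The hypothesis says that y is unmatched, so the edge x y is augmenting: nothing is lost, and
    -- the gain of x alone makes the inequality strict.
    missed-augment : z ≡ y → ∣ missed Y (rematch m x y) ∣ < ∣ missed Y m ∣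
    missed-augment z≡y = ℕ.≤-<-trans (p⊆q⇒∣p∣≤∣q∣ sub) (x∈p⇒∣p-x∣<∣p∣ (∈missed⁺ m x∈Y mx≡x))
      where
      sub : missed Y (rematch m x y) ⊆ missed Y m - x
      sub v∈ with missed-rematch v∈
      ... | _   , v≢y , inj₁ refl = contradiction z≡y v≢y
      ... | v≢x , _   , inj₂ v∈m  = x∈p∧x≢y⇒x∈p-y v∈m v≢x

  -- Maximum matchings and Gallai's lemma

  module Extremal {Y : Subset n} {D : ℕ}
                  (D≤ : ∀ m → IsMatchingOn Y m → D ≤ ∣ missed Y m ∣) where

    -- Attaining the lower bound D forces m to be maximum; that D is attained at all is not assumed
    -- here.
    IsMaximum : Vec (Fin n) n → Set
    IsMaximum m = IsMatchingOn Y m × ∣ missed Y m ∣ ≡ D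

    -- Distinct such x and y would allow an augmentation. The conclusion is an equality because a
    -- loop makes a vertex adjacent to itself.
    maximum-augment : ∀ {m x y} → IsMaximum m → x ∈ Y → y ∈ Y →
                      lookup m x ≡ x → lookup m y ≡ y → Adj x y → x ≡ y
    maximum-augment {m} {x} {y} (M , ∣m∣≡D) x∈ y∈ mx my x~y with x ≟ y
    ... | yes x≡y = x≡y
    ... | no x≢y  = contradiction
      (ℕ.<-≤-trans (missed-augment M x∈ y∈ mx x≢y x~y my) (ℕ.≤-reflexive ∣m∣≡D))
      (ℕ.≤⇒≯ (D≤ _ (rematch-isMatching M x∈ y∈ mx x≢y x~y)))

    infix 4 _≈_

    -- The relation whose transitivity is the core of Gallai's lemma; concluding `u ≡ v` instead of
    -- absurdity makes it reflexive.
    _≈_ : Fin n → Fin n → Set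
    u ≈ v = ∀ m → IsMaximum m → lookup m u ≡ u → lookup m v ≡ v → u ≡ v

    private
      differ? : (m m′ : Vec (Fin n) n) (v : Fin n) → Dec (lookup m v ≢ lookup m′ v)
      differ? m m′ v = ¬? (lookup m v ≟ lookup m′ v)

      disagreement : Vec (Fin n) n → Vec (Fin n) n → Subset n
      disagreement m m′ = ⟦ differ? m m′ ⟧

    -- If a maximum matching m missed u and v but not t, then a maximum matching
    -- m′ missing t covers both u and v, so it misses some x ≢ t covered by m.
    -- Its partner y under m is covered by m′; rematching y to x in m′
    -- brings m′ closer to m.
    ≈-trans : (∀ v → v ∈ Y → ∃ λ m → IsMaximum m × lookup m v ≡ v) →
              ∀ {u t v} → u ∈ Y → t ∈ Y → v ∈ Y → u ≈ t → t ≈ v → u ≈ v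
    ≈-trans missable {u} {t} {v} u∈ t∈ v∈ u≈t t≈v m Mm@(M , ∣m∣≡D) mu mv
      with lookup m t ≟ t
    ... | yes mt = trans (u≈t m Mm mu mt) (t≈v m Mm mt mv)
    ... | no mt≢t with u ≟ v
    ...   | yes u≡v = u≡v
    ...   | no u≢v = let (m′ , Mm′ , m′t) = missable t t∈ in
                     contradiction m′t (approach m′ Mm′ (<-wellFounded _))
      where
      approach : ∀ m′ → IsMaximum m′ → Acc _<_ ∣ disagreement m m′ ∣ → lookup m′ t ≢ t
      approach m′ Mm′@(M′ , ∣m′∣≡D) (acc closer) m′t
        with any? (λ x → ¬? (x ≟ t) ×-dec ((x ∈? missed Y m′) ×-dec ¬? (lookup m x ≟ x)))
      -- With no such x, all that m′ misses besides t is missed by m and differs from u and v. Then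
      -- D - 1 ≤ D - 2, as both matchings miss D vertices.
      ... | no none = ℕ.1+n≰n (begin
        suc (suc ∣ missed Y m - u - v ∣)    ≡⟨ cong suc (x∈p⇒∣p∣≡1+∣p-x∣ v∈m-u) ⟨
        suc ∣ missed Y m - u ∣              ≡⟨ x∈p⇒∣p∣≡1+∣p-x∣ (∈missed⁺ m u∈ mu) ⟨
        ∣ missed Y m ∣                      ≡⟨ trans ∣m∣≡D (sym ∣m′∣≡D) ⟩
        ∣ missed Y m′ ∣                     ≡⟨ x∈p⇒∣p∣≡1+∣p-x∣ (∈missed⁺ m′ t∈ m′t) ⟩
        suc ∣ missed Y m′ - t ∣             ≤⟨ s≤s (p⊆q⇒∣p∣≤∣q∣ sub) ⟩
        suc ∣ missed Y m - u - v ∣          ∎)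
        where
        open ℕ.≤-Reasoning
        v∈m-u : v ∈ missed Y m - u
        v∈m-u = x∈p∧x≢y⇒x∈p-y (∈missed⁺ m v∈ mv) (u≢v ∘ sym)
        sub : missed Y m′ - t ⊆ missed Y m - u - v
        sub {w} w∈ with lookup m w ≟ w
        ... | no mw≢w = contradiction (w , x∈p-y⇒x≢y w∈ , p─q⊆p _ _ w∈ , mw≢w) none
        ... | yes mw  =
          let (w∈Y , m′w) = ∈missed⁻ m′ (p─q⊆p _ _ w∈) in
          x∈p∧x≢y⇒x∈p-y
            (x∈p∧x≢y⇒x∈p-y (∈missed⁺ m w∈Y mw)
              λ { refl → x∈p-y⇒x≢y w∈ (u≈t m′ Mm′ m′w m′t) })
            λ { refl → x∈p-y⇒x≢y w∈ (sym (t≈v m′ Mm′ m′t m′w)) }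
      ... | yes (x , x≢t , x∈m′ , mx≢x) =
        approach (rematch m′ x y) (R , ℕ.≤-antisym (ℕ.≤-trans shrink (ℕ.≤-reflexive ∣m′∣≡D)) (D≤ _ R))
                 (closer (p⊂q⇒∣p∣<∣q∣ (agree , x , x∈dis , x∉dis))) r-t
        where
        y = lookup m x
        m′x = proj₂ (∈missed⁻ m′ x∈m′)
        x∈Y = proj₁ (edge M x mx≢x)
        x~y = proj₂ (edge M x mx≢x)
        y∈Y = mate∈ M mx≢x
        x≢y : x ≢ y
        x≢y x≡y = mx≢x (sym x≡y)
        m′y≢y : lookup m′ y ≢ y
        m′y≢y m′y = x≢y (maximum-augment Mm′ x∈Y y∈Y m′x m′y x~y)
        R = rematch-isMatching M′ x∈Y y∈Y m′x x≢y x~y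
        shrink = ∣missed-rematch∣ M′ x∈Y y∈Y m′x x≢y x~y

        r-t : lookup (rematch m′ x y) t ≡ t
        r-t with rematched m′ x≢y t
        ... | at-x t≡x _    = contradiction (sym t≡x) x≢t
        ... | at-y refl _   = contradiction m′t m′y≢y
        ... | at-z _ _ _ eq = eq
        ... | else _ _ _ eq = trans eq m′t

        x∈dis : x ∈ disagreement m m′
        x∈dis = ∈⟦⟧⁺ (differ? m m′) λ y≡m′x → mx≢x (trans y≡m′x m′x)

        agree-x : lookup (rematch m′ x y) x ≡ y
        agree-x with rematched m′ x≢y x
        ... | at-x _ eq      = eq
        ... | at-y x≡y _     = contradiction x≡y x≢y
        ... | at-z x≢x _ _ _ = contradiction refl x≢x
        ... | else x≢x _ _ _ = contradiction refl x≢x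

        x∉dis : x ∉ disagreement m (rematch m′ x y)
        x∉dis x∈ = ∈⟦⟧⁻ (differ? m (rematch m′ x y)) x∈ (sym agree-x)

        agree : disagreement m (rematch m′ x y) ⊆ disagreement m m′
        agree {w} w∈ = ∈⟦⟧⁺ (differ? m m′) λ mw≡m′w → ∈⟦⟧⁻ (differ? m (rematch m′ x y)) w∈ (same mw≡m′w)
          where
          same : lookup m w ≡ lookup m′ w → lookup m w ≡ lookup (rematch m′ x y) w
          same mw≡m′w with rematched m′ x≢y w
          ... | at-x refl eq = sym eq
          ... | at-y refl eq = trans (invol M x) (sym eq)
          ... | else _ _ _ eq = trans mw≡m′w (sym eq)
          -- The old partner w of y under m′ is the one place where an agreement could be destroyed.
          -- But m w ≡ m′ w ≡ y would give w ≡ m y ≡ x.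
          ... | at-z w≢x _ refl _ = contradiction
            (trans (sym (invol M w)) (trans (cong (lookup m) (trans mw≡m′w (invol M′ y))) (invol M x))) w≢x

  -- Barriers whose complement has only missable vertices

  -- In the language of Gallai and Edmonds, `missable` says that every vertex of X ─ S is
  -- inessential in the graph induced there; it also shows `bound` to be attained as soon as X ─ S
  -- is nonempty.
  record Barrier (X S : Subset n) (d : ℕ) : Set where
    field
      S⊆X      : S ⊆ X
      bound    : ∀ m → IsMatchingOn (X ─ S) m → ∣ S ∣ + d ≤ ∣ missed (X ─ S) m ∣
      missable : ∀ v → v ∈ X ─ S → ∃ λ m →
                 (IsMatchingOn (X ─ S) m × ∣ missed (X ─ S) m ∣ ≡ ∣ S ∣ + d) × lookup m v ≡ v

  -- Take S maximal subject to `bound`.  Maximality gives for each v a matching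
  -- missing v that exceeds the bound by at most one, and by parity it meets it.
  barrier : ∀ X d → (∀ m → IsMatchingOn X m → d ≤ ∣ missed X m ∣) →
            parity ∣ X ∣ ≡ parity d → ∃ λ S → Barrier X S d
  barrier X d d≤ ∣X∣≡d =
    grow ⊥ (λ x∈ → contradiction x∈ ∉⊥)
      (subst₂ (λ Y k → ∀ m → IsMatchingOn Y m → k + d ≤ ∣ missed Y m ∣)
              (sym (p─⊥≡p X)) (sym (∣⊥∣≡0 n)) d≤)
      (<-wellFounded _)
    where
    grow : ∀ S → S ⊆ X → (∀ m → IsMatchingOn (X ─ S) m → ∣ S ∣ + d ≤ ∣ missed (X ─ S) m ∣) →
           Acc _<_ ∣ X ─ S ∣ → ∃ λ S → Barrier X S d
    grow S S⊆X bound (acc rec) = step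
      where
      Y = X ─ S
      -- If no m satisfies this, then `bound` holds for S ∪ {v}, whose required value is one more
      -- than |S| + d.
      NearlyTight : Fin n → Vec (Fin n) n → Set
      NearlyTight v m = IsMatchingOn (Y - v) m × ∣ missed (Y - v) m ∣ ≤ ∣ S ∣ + d

      nearlyTight? : ∀ v → Dec (∃ (NearlyTight v))
      nearlyTight? v = anyVec? λ m → isMatchingOn? (Y - v) m ×-dec (_ ℕ.≤? _)

      parity-Y : parity ∣ Y ∣ ≢ parity (suc (∣ S ∣ + d))
      parity-Y eq = parity-suc-≢ (∣ S ∣ + d) (begin
        parity (suc (∣ S ∣ + d))    ≡⟨ eq ⟨
        -- |Y| + |S| = |X| has the parity of d, and moving |S| across does not matter modulo 2.
        parity ∣ Y ∣                ≡⟨ parity-swap {∣ Y ∣} (trans (cong parity (p⊆q⇒∣q─p∣+∣p∣≡∣q∣ S⊆X)) ∣X∣≡d) ⟩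
        parity (∣ S ∣ + d)          ∎)
        where open ≡-Reasoning

      tight : ∀ v → v ∈ Y → ∃ (NearlyTight v) → ∃ λ m →
              (IsMatchingOn Y m × ∣ missed Y m ∣ ≡ ∣ S ∣ + d) × lookup m v ≡ v
      tight v v∈Y (m , M , few) = m , (M′ , ∣m∣≡) , mv≡v
        where
        M′ = IsMatchingOn-⊆ (p─q⊆p Y ⁅ v ⁆) M
        mv≡v : lookup m v ≡ v
        mv≡v with lookup m v ≟ v
        ... | yes eq = eq
        ... | no neq = contradiction (proj₁ (edge M v neq)) x∉p-x
        ∣m∣≤ : ∣ missed Y m ∣ ≤ suc (∣ S ∣ + d)
        ∣m∣≤ = begin
          ∣ missed Y m ∣              ≡⟨ x∈p⇒∣p∣≡1+∣p-x∣ (∈missed⁺ m v∈Y mv≡v) ⟩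
          suc ∣ missed Y m - v ∣      ≤⟨ s≤s (p⊆q⇒∣p∣≤∣q∣ sub) ⟩
          suc ∣ missed (Y - v) m ∣    ≤⟨ s≤s few ⟩
          suc (∣ S ∣ + d)             ∎
          where
          open ℕ.≤-Reasoning
          sub : missed Y m - v ⊆ missed (Y - v) m
          sub w∈ = let (w∈Y , mw) = ∈missed⁻ m (p─q⊆p _ _ w∈) in
            ∈missed⁺ m (x∈p∧x≢y⇒x∈p-y w∈Y (x∈p-y⇒x≢y w∈)) mw
        ∣m∣≡ : ∣ missed Y m ∣ ≡ ∣ S ∣ + d
        ∣m∣≡ = ℕ.≤-antisym
          (ℕ.≤-pred (ℕ.≤∧≢⇒< ∣m∣≤ λ eq → parity-Y (trans (sym (parity-missed M′)) (cong parity eq))))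
          (bound m M′)

      step : ∃ λ S → Barrier X S d
      step with any? (λ v → (v ∈? Y) ×-dec ¬? (nearlyTight? v))
      ... | no none = S , record
        { S⊆X = S⊆X ; bound = bound
        ; missable = λ v v∈Y → tight v v∈Y
            (decidable-stable (nearlyTight? v) λ ¬tight → none (v , v∈Y , ¬tight)) }
      ... | yes (v , v∈Y , ¬tight) =
        grow S′ S′⊆X (subst₂ (λ Z k → ∀ m → IsMatchingOn Z m → k + d ≤ ∣ missed Z m ∣)
                             (p─q─r≡p─q∪r X S ⁅ v ⁆) (sym (∣p∪⁅x⁆∣ v∉S))
                             λ m M → ℕ.≰⇒> λ few → ¬tight (m , M , few))
             (rec (subst (λ Z → ∣ Z ∣ < ∣ Y ∣) (p─q─r≡p─q∪r X S ⁅ v ⁆) (x∈p⇒∣p-x∣<∣p∣ v∈Y)))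
        where
        S′ = S ∪ ⁅ v ⁆
        v∉S = x∈p─q⇒x∉q v∈Y
        S′⊆X : S′ ⊆ X
        S′⊆X w∈ with x∈p∪q⁻ S ⁅ v ⁆ w∈
        ... | inj₁ w∈S = S⊆X w∈S
        ... | inj₂ w∈v = subst (_∈ X) (sym (x∈⁅y⁆⇒x≡y v w∈v)) (p─q⊆p X S v∈Y)

-- Comparing sums, and enumerating subsets

sum-mono : {f g : Fin n → ℕ} → (∀ i → f i ≤ g i) → sum f ≤ sum g
sum-mono {zero}  f≤g = z≤n
sum-mono {suc n} f≤g = ℕ.+-mono-≤ (f≤g zero) (sum-mono (f≤g ∘ suc))

-- This turns one equality of totals into an equality at each edge and at each vertex.
sum-squeeze : {f g : Fin n → ℕ} → (∀ i → f i ≤ g i) → sum g ≤ sum f → ∀ i → f i ≡ g i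
sum-squeeze {suc n} {f} {g} f≤g Σg≤Σf zero    = ℕ.≤-antisym (f≤g zero)
  (ℕ.+-cancelʳ-≤ (sum (f ∘ suc)) _ _ (ℕ.≤-trans (ℕ.+-monoʳ-≤ (g zero) (sum-mono (f≤g ∘ suc))) Σg≤Σf))
sum-squeeze {suc n} {f} {g} f≤g Σg≤Σf (suc i) = sum-squeeze (f≤g ∘ suc)
  (ℕ.+-cancelˡ-≤ (f zero) _ _ (ℕ.≤-trans (ℕ.+-monoˡ-≤ (sum (g ∘ suc)) (f≤g zero)) Σg≤Σf)) i

∑χ*≟ : (p : Subset n) (x : Fin n) → ∑[ v < n ] (χ (lookup p v) * χ (does (x ≟ v))) ≡ χ (lookup p x)
∑χ*≟ {suc n} (b ∷ p) zero = trans
  (cong₂ _+_ (ℕ.*-identityʳ (χ b))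
             (trans (sum-cong-≗ λ v → ℕ.*-zeroʳ (χ (lookup p v))) (sum-replicate-zero n)))
  (ℕ.+-identityʳ (χ b))
∑χ*≟ (b ∷ p) (suc x) = trans
  (cong₂ _+_ (ℕ.*-zeroʳ (χ b)) (∑χ*≟ p x)) refl

lookup-∉ : {p : Subset n} {i : Fin n} → i ∉ p → lookup p i ≡ false
lookup-∉ {p = p} {i} i∉p with lookup p i in eq
... | true  = contradiction (lookup⇒[]= i p eq) i∉p
... | false = refl

lookup-─ : (p q : Subset n) (i : Fin n) → lookup (p ─ q) i ≡ lookup p i ∧ not (lookup q i)
lookup-─ (false ∷ p) (true ∷ q)  zero    = refl
lookup-─ (false ∷ p) (false ∷ q) zero    = refl
lookup-─ (true ∷ p)  (true ∷ q)  zero    = refl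
lookup-─ (true ∷ p)  (false ∷ q) zero    = refl
lookup-─ (_ ∷ p)     (_ ∷ q)     (suc i) = lookup-─ p q i

∣p∣≤1 : {p : Subset n} → (∀ {i j} → i ∈ p → j ∈ p → i ≡ j) → ∣ p ∣ ≤ 1
∣p∣≤1 {p = p} unique with nonempty? p
... | no empty = subst (_≤ 1) (sym (Empty⇒∣p∣≡0 empty)) z≤n
... | yes (i , i∈p) = ℕ.≤-trans
  (p⊆q⇒∣p∣≤∣q∣ λ j∈p → subst (_∈ ⁅ i ⁆) (unique i∈p j∈p) (x∈⁅x⁆ i))
  (ℕ.≤-reflexive (∣⁅x⁆∣≡1 i))

length-filter-tabulate : {A : Set} {P : A → Set} (P? : Decidable P) (f : Fin n → A) →
                         List.length (filter P? (List.tabulate f)) ≡ ∣ ⟦ (λ i → P? (f i)) ⟧ ∣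
length-filter-tabulate {zero}  P? f = refl
length-filter-tabulate {suc n} P? f with P? (f zero)
... | yes _ = cong suc (length-filter-tabulate P? (f ∘ suc))
... | no  _ = length-filter-tabulate P? (f ∘ suc)

⟦∈?⟧ : (p : Subset n) → ⟦ (_∈? p) ⟧ ≡ p
⟦∈?⟧ p = ⊆-antisym (∈⟦⟧⁻ (_∈? p)) (∈⟦⟧⁺ (_∈? p))

-- Components and edge cuts

module _ {G : Graph} where
  open Graph G

  subgraph-≡ : {H K : Subgraph G} → V H ≡ V K → E H ≡ E K → H ≡ K
  subgraph-≡ refl refl = refl

  ⊑-antisym : {H K : Subgraph G} → H ⊑ K → K ⊑ H → H ≡ K
  ⊑-antisym (V⊆ , E⊆) (V⊇ , E⊇) = subgraph-≡ (⊆-antisym V⊆ V⊇) (⊆-antisym E⊆ E⊇)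

  Linked-sym : (K : Subgraph G) {u v : Vertex} → Linked K u v → Linked K v u
  Linked-sym K = reverse λ (e , e∈ , joins) → e , e∈ , swap joins

  Linked-∈ : (K : Subgraph G) {u v : Vertex} → Linked K u v → u ∈ V K → v ∈ V K
  Linked-∈ K ε u∈ = u∈
  Linked-∈ K ((e , e∈ , inj₁ (refl , refl)) ◅ l) _ = Linked-∈ K l (proj₂ (ends∈V K e∈))
  Linked-∈ K ((e , e∈ , inj₂ (refl , refl)) ◅ l) _ = Linked-∈ K l (proj₁ (ends∈V K e∈))

  Closed : Subgraph G → VertexSet → Set
  Closed K R = ∀ e → e ∈ E K → (src e ∈ R → tgt e ∈ R) × (tgt e ∈ R → src e ∈ R)

  -- A walk of unbounded length is not directly decidable. Here reachability becomes a finite set: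
  -- `linked` makes it small enough, and `source` with `closed` large enough, to be exactly the
  -- vertices linked to u.
  record Reachable (K : Subgraph G) (u : Vertex) : Set where
    field
      R      : VertexSet
      source : u ∈ R
      linked : ∀ {v} → v ∈ R → Linked K u v
      closed : Closed K R

  abstract
    reachable : ∀ K u → Reachable K u
    reachable K u = grow ⁅ u ⁆ (x∈⁅x⁆ u)
      (λ v∈ → subst (Linked K u) (sym (x∈⁅y⁆⇒x≡y u v∈)) ε) (<-wellFounded _)
      where
      grow : ∀ R → u ∈ R → (∀ {v} → v ∈ R → Linked K u v) → Acc _<_ ∣ ∁ R ∣ → Reachable K u
      grow R u∈R linked (acc rec) = step
        where
        extend : ∀ {x y} → x ∈ R → y ∉ R → Adjacent K x y → Reachable K u
        extend {x} {y} x∈R y∉R x~y = grow (R ∪ ⁅ y ⁆) (p⊆p∪q ⁅ y ⁆ u∈R) linked′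
          (rec (p⊂q⇒∣p∣<∣q∣ (p⊂q⇒∁p⊃∁q (p⊆p∪q ⁅ y ⁆ , y , q⊆p∪q R ⁅ y ⁆ (x∈⁅x⁆ y) , y∉R))))
          where
          linked′ : ∀ {v} → v ∈ R ∪ ⁅ y ⁆ → Linked K u v
          linked′ v∈ with x∈p∪q⁻ R ⁅ y ⁆ v∈
          ... | inj₁ v∈R = linked v∈R
          ... | inj₂ v∈y = subst (Linked K u) (sym (x∈⁅y⁆⇒x≡y y v∈y)) (linked x∈R ◅◅ x~y ◅ ε)

        step : Reachable K u
        step with any? (λ e → (e ∈? E K) ×-dec ((src e ∈? R) ×-dec ¬? (tgt e ∈? R)))
                | any? (λ e → (e ∈? E K) ×-dec ((tgt e ∈? R) ×-dec ¬? (src e ∈? R)))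
        ... | yes (e , e∈ , s∈ , t∉) | _ = extend s∈ t∉ (e , e∈ , inj₁ (refl , refl))
        ... | no _ | yes (e , e∈ , t∈ , s∉) = extend t∈ s∉ (e , e∈ , inj₂ (refl , refl))
        ... | no none₁ | no none₂ = record
          { R = R ; source = u∈R ; linked = linked
          ; closed = λ e e∈ →
              (λ s∈ → decidable-stable (tgt e ∈? R) λ t∉ → none₁ (e , e∈ , s∈ , t∉)) ,
              (λ t∈ → decidable-stable (src e ∈? R) λ s∉ → none₂ (e , e∈ , t∈ , s∉)) }

  open Reachable

  -- Testing one end of an edge suffices, since R is closed along the edges of K.
  component : Subgraph G → Vertex → Subgraph G
  component K u = mkSubgraph (R r) (E K ∩ ⟦ (λ e → src e ∈? R r) ⟧) λ {e} e∈ →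
    let (e∈K , e∈R) = x∈p∩q⁻ (E K) _ e∈
        s∈ = ∈⟦⟧⁻ (λ e → src e ∈? R r) e∈R
    in s∈ , proj₁ (closed r e e∈K) s∈
    where r = reachable K u

  module _ (K : Subgraph G) (u : Vertex) where
    private
      r = reachable K u
      C = component K u

    ∈component : u ∈ V C
    ∈component = source r

    component-linked : ∀ {v} → v ∈ V C → Linked K u v
    component-linked = linked r

    component-closed : Closed K (V C)
    component-closed = closed r

    ∈E-component : ∀ {e} → e ∈ E K → src e ∈ V C → e ∈ E C
    ∈E-component e∈ s∈ = x∈p∩q⁺ (e∈ , ∈⟦⟧⁺ (λ e → src e ∈? V C) s∈)

    linked-component : ∀ {v w} → v ∈ V C → Linked K v w → w ∈ V C × Linked C v w
    linked-component v∈ ε = v∈ , ε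
    linked-component v∈ ((e , e∈ , inj₁ (refl , refl)) ◅ l) =
      let (w∈ , l′) = linked-component (proj₁ (component-closed e e∈) v∈) l
      in w∈ , (e , ∈E-component e∈ v∈ , inj₁ (refl , refl)) ◅ l′
    linked-component v∈ ((e , e∈ , inj₂ (refl , refl)) ◅ l) =
      let s∈ = proj₂ (component-closed e e∈) v∈
          (w∈ , l′) = linked-component s∈ l
      in w∈ , (e , ∈E-component e∈ s∈ , inj₂ (refl , refl)) ◅ l′

    component-connected : Connected C
    component-connected = (u , ∈component) , λ v w v∈ w∈ →
      proj₂ (linked-component v∈ (Linked-sym K (component-linked v∈) ◅◅ component-linked w∈))

    component-⊑ : u ∈ V K → C ⊑ K
    component-⊑ u∈ = (λ v∈ → Linked-∈ K (component-linked v∈) u∈) , p∩q⊆p (E K) _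

    connected⊑component : ∀ L {w} → Connected L → L ⊑ K → w ∈ V L → w ∈ V C → L ⊑ C
    connected⊑component L {w} (_ , conn) (V⊆ , E⊆) w∈L w∈C = sub , λ e∈ →
      ∈E-component (E⊆ e∈) (sub (proj₁ (ends∈V L e∈)))
      where
      lift : ∀ {x y} → Linked L x y → Linked K x y
      lift ε = ε
      lift ((e , e∈ , j) ◅ l) = (e , E⊆ e∈ , j) ◅ lift l
      sub : V L ⊆ V C
      sub v∈ = proj₁ (linked-component w∈C (lift (conn w _ w∈L v∈)))

    component-isComponent : u ∈ V K → IsComponent K C
    component-isComponent u∈ = component-connected , component-⊑ u∈ , λ L conn L⊑K C⊑L →
      ⊑-antisym (connected⊑component L conn L⊑K (proj₁ C⊑L ∈component) ∈component) C⊑L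

    isComponent⇒≡component : ∀ L → IsComponent K L → u ∈ V L → L ≡ C
    isComponent⇒≡component L (conn , L⊑K , maximal) u∈L =
      sym (maximal C component-connected (component-⊑ (proj₁ L⊑K u∈L))
                   (connected⊑component L conn L⊑K u∈L ∈component))

  ∈δ⁻ : (L : Subgraph G) {e : Edge} → e ∈ δ L →
        (src e ∈ V L × tgt e ∉ V L) ⊎ (src e ∉ V L × tgt e ∈ V L)
  ∈δ⁻ L {e} e∈ with src e ∈? V L | tgt e ∈? V L
                  | trans (sym (lookup∘tabulate _ e)) ([]=⇒lookup e∈)
  ... | yes s∈ | no t∉  | _ = inj₁ (s∈ , t∉)
  ... | no s∉  | yes t∈ | _ = inj₂ (s∉ , t∈)
  ... | yes s∈ | yes t∈ | eq rewrite []=⇒lookup s∈ | []=⇒lookup t∈ = contradiction eq λ ()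
  ... | no s∉  | no t∉  | eq rewrite lookup-∉ s∉ | lookup-∉ t∉ = contradiction eq λ ()

  -- If e were the only edge of the cut, membership in V L would be constant along walks avoiding e.
  -- The ends of e lie on different sides, so e would be a bridge.
  ∣δ∣≢1 : Bridgeless G → (L : Subgraph G) → ∣ δ L ∣ ≢ 1
  ∣δ∣≢1 bridgeless L ∣δ∣≡1 with nonempty? (δ L)
  ... | no empty = contradiction (trans (sym (Empty⇒∣p∣≡0 empty)) ∣δ∣≡1) λ ()
  ... | yes (e , e∈) = bridgeless (e , λ l → crossing (∈δ⁻ L e∈) l)
    where
    e-only : ∀ {f} → f ∈ δ L → f ≡ e
    e-only {f} f∈ with f ≟ e
    ... | yes f≡e = f≡e
    ... | no f≢e  = contradiction
      (trans (sym ∣δ∣≡1) (trans (x∈p⇒∣p∣≡1+∣p-x∣ e∈)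
        (cong suc (x∈p⇒∣p∣≡1+∣p-x∣ (x∈p∧x≢y⇒x∈p-y f∈ f≢e))))) λ ()

    same-side : ∀ {u v} → Linked (whole G ∖ₑ e) u v → lookup (V L) u ≡ lookup (V L) v
    same-side ε = refl
    same-side {v = v} ((f , f∈ , joins) ◅ l) = trans (step joins) (same-side l)
      where
      f-same : lookup (V L) (src f) ≡ lookup (V L) (tgt f)
      f-same with lookup (V L) (src f) in s | lookup (V L) (tgt f) in t
      ... | true  | true  = refl
      ... | false | false = refl
      ... | true  | false = contradiction (e-only (lookup⇒[]= f _
        (trans (lookup∘tabulate _ f) (cong₂ _xor_ s t)))) (x∈p-y⇒x≢y f∈)
      ... | false | true  = contradiction (e-only (lookup⇒[]= f _
        (trans (lookup∘tabulate _ f) (cong₂ _xor_ s t)))) (x∈p-y⇒x≢y f∈)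
      step : ∀ {x y} → Joins f x y → lookup (V L) x ≡ lookup (V L) y
      step (inj₁ (refl , refl)) = f-same
      step (inj₂ (refl , refl)) = sym f-same

    crossing : (src e ∈ V L × tgt e ∉ V L) ⊎ (src e ∉ V L × tgt e ∈ V L) →
               ¬ Linked (whole G ∖ₑ e) (src e) (tgt e)
    crossing (inj₁ (s∈ , t∉)) l = t∉ (lookup⇒[]= _ _ (trans (sym (same-side l)) ([]=⇒lookup s∈)))
    crossing (inj₂ (s∉ , t∈)) l = s∉ (lookup⇒[]= _ _ (trans (same-side l) ([]=⇒lookup t∈)))

  degree-whole : ∀ v → degree (whole G) v ≡
                 ∑[ e < nE ] (χ (does (src e ≟ v)) + χ (does (tgt e ≟ v)))
  degree-whole v = trans (cong₂ _+_ (count-ends src) (count-ends tgt))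
    (sym (∑-distrib-+ (λ e → χ (does (src e ≟ v))) (λ e → χ (does (tgt e ≟ v)))))
    where
    count-ends : (end : Edge → Vertex) →
      ∣ ⊤ ∩ tabulate (λ e → does (end e ≟ v)) ∣ ≡ ∑[ e < nE ] χ (does (end e ≟ v))
    count-ends end = trans (cong ∣_∣ (∩-identityˡ (tabulate λ e → does (end e ≟ v))))
                           (∣tabulate∣≡∑χ λ e → does (end e ≟ v))

  -- Double counting of the edge ends in S: by vertices, three each, and by edges. A loop counts
  -- twice both ways.
  handshake : Cubic G → (S : VertexSet) →
              ∣ S ∣ * 3 ≡ ∑[ e < nE ] (χ (lookup S (src e)) + χ (lookup S (tgt e)))
  handshake cubic S = begin
    ∣ S ∣ * 3
      ≡⟨ cong (_* 3) (∣p∣≡∑χ S) ⟩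
    (∑[ v < nV ] s v) * 3
      ≡⟨ *-distribʳ-sum 3 s ⟩
    ∑[ v < nV ] (s v * 3)
      ≡⟨ sum-cong-≗ (λ v → cong (s v *_) (trans (sym (cubic v)) (degree-whole v))) ⟩
    ∑[ v < nV ] (s v * ∑[ e < nE ] (a v e + b v e))
      ≡⟨ sum-cong-≗ (λ v → *-distribˡ-sum (s v) (λ e → a v e + b v e)) ⟩
    ∑[ v < nV ] ∑[ e < nE ] (s v * (a v e + b v e))
      ≡⟨ ∑-comm (λ v e → s v * (a v e + b v e)) ⟩
    ∑[ e < nE ] ∑[ v < nV ] (s v * (a v e + b v e))
      ≡⟨ sum-cong-≗ (λ e → trans (sum-cong-≗ λ v → ℕ.*-distribˡ-+ (s v) (a v e) (b v e))
                                 (∑-distrib-+ (λ v → s v * a v e) (λ v → s v * b v e))) ⟩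
    ∑[ e < nE ] (∑[ v < nV ] (s v * a v e) + ∑[ v < nV ] (s v * b v e))
      ≡⟨ sum-cong-≗ (λ e → cong₂ _+_ (∑χ*≟ S (src e)) (∑χ*≟ S (tgt e))) ⟩
    ∑[ e < nE ] (χ (lookup S (src e)) + χ (lookup S (tgt e)))
      ∎
    where
    open ≡-Reasoning
    s : Vertex → ℕ
    s v = χ (lookup S v)
    a b : Vertex → Edge → ℕ
    a v e = χ (does (src e ≟ v))
    b v e = χ (does (tgt e ≟ v))

  -- By `handshake`, 3|V L| is |δ L| plus twice the number of edges with both ends in V L, and 3 is
  -- odd.
  parity-∣δ∣ : Cubic G → (L : Subgraph G) → parity ∣ δ L ∣ ≡ parity ∣ V L ∣
  parity-∣δ∣ cubic L = sym (begin
    parity ∣ V L ∣                          ≡⟨ ℙ.*-identityʳ _ ⟨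
    parity ∣ V L ∣ ℙ.* 1ℙ                   ≡⟨ ℙ.*-homo-* ∣ V L ∣ 3 ⟨
    parity (∣ V L ∣ * 3)                    ≡⟨ cong parity (trans (handshake cubic (V L)) split) ⟩
    parity (∣ δ L ∣ + (sum i + sum i))      ≡⟨ +-homo-+ ∣ δ L ∣ _ ⟩
    parity ∣ δ L ∣ ℙ.+ parity (sum i + sum i) ≡⟨ cong (parity ∣ δ L ∣ ℙ.+_) (n+n-even (sum i)) ⟩
    parity ∣ δ L ∣ ℙ.+ 0ℙ                   ≡⟨ ℙ.+-identityʳ _ ⟩
    parity ∣ δ L ∣                          ∎)
    where
    open ≡-Reasoning
    l : Vertex → Bool
    l = lookup (V L)
    i x : Edge → ℕ
    i e = χ (l (src e) ∧ l (tgt e))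
    x e = χ (l (src e) xor l (tgt e))
    bits : ∀ a b → χ a + χ b ≡ χ (a xor b) + (χ (a ∧ b) + χ (a ∧ b))
    bits true  true  = refl
    bits true  false = refl
    bits false true  = refl
    bits false false = refl
    split : ∑[ e < nE ] (χ (l (src e)) + χ (l (tgt e))) ≡ ∣ δ L ∣ + (sum i + sum i)
    split = trans (sum-cong-≗ λ e → bits (l (src e)) (l (tgt e)))
      (trans (∑-distrib-+ x (λ e → i e + i e))
        (cong₂ _+_ (sym (∣tabulate∣≡∑χ λ e → l (src e) xor l (tgt e)))
                   (∑-distrib-+ i i)))

  odd⇒∣δ∣≥3 : Bridgeless G → Cubic G → (L : Subgraph G) → parity ∣ V L ∣ ≡ 1ℙ → 3 ≤ ∣ δ L ∣
  odd⇒∣δ∣≥3 bridgeless cubic L odd with ∣ δ L ∣ | ∣δ∣≢1 bridgeless L | trans (parity-∣δ∣ cubic L) odd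
  ... | 0                   | _  | ()
  ... | 1                   | ≢1 | _ = contradiction refl ≢1
  ... | 2                   | _  | ()
  ... | suc (suc (suc _))   | _  | _ = s≤s (s≤s (s≤s z≤n))

∣p∣≢0⇒Nonempty : {p : Subset n} → ∣ p ∣ ≢ 0 → Nonempty p
∣p∣≢0⇒Nonempty {p = p} ∣p∣≢0 = decidable-stable (nonempty? p) (∣p∣≢0 ∘ Empty⇒∣p∣≡0)

parity≡1⇒odd : ∀ n → parity n ≡ 1ℙ → n % 2 ≡ 1
parity≡1⇒odd 1             _   = refl
parity≡1⇒odd (suc (suc n)) odd = parity≡1⇒odd n odd

-- Injectivity is asked on members only, because `C` separates the representatives but not arbitrary
-- vertices.
unique-map : {A B : Set} (f : A → B) {xs : List A} →
             (∀ {x y} → x ∈ₗ xs → y ∈ₗ xs → f x ≡ f y → x ≡ y) → Unique xs → Unique (List.map f xs)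
unique-map f inj []              = []
unique-map f inj (x∉xs ∷ unique) =
  All.map⁺ (All.tabulate λ y∈ fx≡fy → All.lookup x∉xs y∈ (inj (here refl) (there y∈) fx≡fy))
  ∷ unique-map f (λ x∈ y∈ → inj (there x∈) (there y∈)) unique

-- From vertex involutions to edge sets

module GraphMatching (G : Graph) where
  open Graph G

  Adj : Vertex → Vertex → Set
  Adj u v = ∃ λ e → Joins e u v

  joins? : ∀ e u v → Dec (Joins e u v)
  joins? e u v = ((src e ≟ u) ×-dec (tgt e ≟ v)) ⊎-dec ((src e ≟ v) ×-dec (tgt e ≟ u))

  Adj? : ∀ u v → Dec (Adj u v)
  Adj? u v = any? λ e → joins? e u v

  Adj-sym : ∀ {u v} → Adj u v → Adj v u
  Adj-sym (e , joins) = e , swap joins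

  open Matching Adj? Adj-sym public

  joined∈E : (H : Subgraph G) → IsInduced H → ∀ {e u v} → Joins e u v → u ∈ V H → v ∈ V H → e ∈ E H
  joined∈E H induced (inj₁ (refl , refl)) u∈ v∈ = induced _ u∈ v∈
  joined∈E H induced (inj₂ (refl , refl)) u∈ v∈ = induced _ v∈ u∈

  ends-of-joining : ∀ {e u v w} → Joins e u v → e IncidentTo w → u ≡ w ⊎ v ≡ w
  ends-of-joining (inj₁ (refl , refl)) incident = incident
  ends-of-joining (inj₂ (refl , refl)) incident = swap incident

  -- One definite edge for each adjacent pair: being selected becomes a decidable equation, and two
  -- edges selected for the same pair coincide.
  firstEdge : Vertex → Vertex → Maybe Edge
  firstEdge u v with Adj? u v
  ... | yes (e , _) = just e
  ... | no  _       = nothing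

  firstEdge-joins : ∀ {u v e} → firstEdge u v ≡ just e → Joins e u v
  firstEdge-joins {u} {v} eq with Adj? u v | eq
  ... | yes (e , joins) | refl = joins

  firstEdge-exists : ∀ {u v} → Adj u v → ∃ λ e → firstEdge u v ≡ just e
  firstEdge-exists {u} {v} u~v with Adj? u v
  ... | yes (e , _) = e , refl
  ... | no ¬u~v     = contradiction u~v ¬u~v

  module _ (H : Subgraph G) (induced : IsInduced H) {m} (M : IsMatchingOn (V H) m) where
    private
      mate = lookup m

      -- v < mate v selects one end of each matched pair, so that parallel
      -- edges are not both chosen.
      Selects : Vertex → Edge → Set
      Selects v e = v <ᶠ mate v × firstEdge v (mate v) ≡ just e

      selected? : ∀ e → Dec (∃ λ v → Selects v e)
      selected? e = any? λ v → (v <ᶠ? mate v) ×-dec ≡-dec _≟_ (firstEdge v (mate v)) (just e)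

      <⇒≢ : ∀ {v} → v <ᶠ mate v → mate v ≢ v
      <⇒≢ v<mv mv≡v = ℕ.<-irrefl (cong toℕ (sym mv≡v)) v<mv

      -- Both matched pairs contain w, so they are the same pair, and u and v are both its smaller
      -- end.
      selects-unique : ∀ {u v e f w} → Selects u e → Selects v f →
                       e IncidentTo w → f IncidentTo w → u ≡ v
      selects-unique {u} {v} (u<mu , eq₁) (v<mv , eq₂) e∋w f∋w
        with ends-of-joining (firstEdge-joins eq₁) e∋w | ends-of-joining (firstEdge-joins eq₂) f∋w
      ... | inj₁ refl | inj₁ v≡w = sym v≡w
      ... | inj₁ refl | inj₂ refl = contradiction u<mu (ℕ.<-asym v<mv ∘ subst (mate v <ᶠ_) (invol M v))
      ... | inj₂ refl | inj₁ refl = contradiction v<mv (ℕ.<-asym u<mu ∘ subst (mate u <ᶠ_) (invol M u))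
      ... | inj₂ refl | inj₂ mv≡mu = trans (sym (invol M u)) (trans (cong mate (sym mv≡mu)) (invol M v))

    perfectMatching : ∣ missed (V H) m ∣ ≡ 0 → HasPerfectMatching H
    perfectMatching none = ⟦ selected? ⟧ , (sub , no-loop , disjoint) , covers
      where
      sub : ⟦ selected? ⟧ ⊆ E H
      sub e∈ with ∈⟦⟧⁻ selected? e∈
      ... | v , v<mv , eq = joined∈E H induced (firstEdge-joins eq)
        (proj₁ (edge M v (<⇒≢ v<mv))) (mate∈ M (<⇒≢ v<mv))

      no-loop : ∀ e → e ∈ ⟦ selected? ⟧ → src e ≢ tgt e
      no-loop e e∈ s≡t with ∈⟦⟧⁻ selected? e∈
      ... | v , v<mv , eq with firstEdge-joins eq
      ...   | inj₁ (s≡v , t≡mv) = <⇒≢ v<mv (trans (sym t≡mv) (trans (sym s≡t) s≡v))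
      ...   | inj₂ (s≡mv , t≡v) = <⇒≢ v<mv (trans (sym s≡mv) (trans s≡t t≡v))

      disjoint : ∀ e f w → e ∈ ⟦ selected? ⟧ → f ∈ ⟦ selected? ⟧ →
                 e IncidentTo w → f IncidentTo w → e ≡ f
      disjoint e f w e∈ f∈ e∋w f∋w with ∈⟦⟧⁻ selected? e∈ | ∈⟦⟧⁻ selected? f∈
      ... | u , sel₁ | v , sel₂ with selects-unique sel₁ sel₂ e∋w f∋w
      ...   | refl = just-injective (trans (sym (proj₂ sel₁)) (proj₂ sel₂))

      select : ∀ v → v <ᶠ mate v → ∃ λ e → e ∈ ⟦ selected? ⟧ × Joins e v (mate v)
      select v v<mv =
        let (e , eq) = firstEdge-exists (proj₂ (edge M v (<⇒≢ v<mv)))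
        in e , ∈⟦⟧⁺ selected? (v , v<mv , eq) , firstEdge-joins eq

      covers : ∀ v → v ∈ V H → ∃ λ e → e ∈ ⟦ selected? ⟧ × e IncidentTo v
      covers v v∈ with <ᶠ-cmp v (mate v)
      ... | tri< v<mv _ _ = let (e , e∈ , joins) = select v v<mv in e , e∈ , first joins
        where
        first : ∀ {e w} → Joins e v w → e IncidentTo v
        first (inj₁ (s , _)) = inj₁ s
        first (inj₂ (_ , t)) = inj₂ t
      ... | tri≈ _ v≡mv _ = contradiction none
        (ℕ.m<n⇒n≢0 (subst (0 <_) (sym (x∈p⇒∣p∣≡1+∣p-x∣ (∈missed⁺ m v∈ (sym v≡mv)))) (s≤s z≤n)))
      ... | tri> _ _ mv<v =
        let (e , e∈ , joins) = select (mate v) (subst (mate v <ᶠ_) (sym (invol M v)) mv<v)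
        in e , e∈ , second (subst (Joins e (mate v)) (invol M v) joins)
        where
        second : ∀ {e u} → Joins e u v → e IncidentTo v
        second (inj₁ (_ , t)) = inj₂ t
        second (inj₂ (s , _)) = inj₁ s

-- Counting edges around a barrier

χ-∧ : ∀ a b → χ (a ∧ b) ≡ χ a * χ b
χ-∧ true  b = sym (ℕ.+-identityʳ (χ b))
χ-∧ false b = refl

-- h and s stand for membership of the two ends in V H and in S: an edge leaving V H ─ S goes either
-- into S or out of H.
χ-xor-─ : ∀ h₁ s₁ h₂ s₂ → χ ((h₁ ∧ not s₁) xor (h₂ ∧ not s₂)) ≤ χ s₁ + χ s₂ + χ (h₁ xor h₂)
χ-xor-─ false false false s₂    = z≤n
χ-xor-─ false false true  false = s≤s z≤n
χ-xor-─ false false true  true  = z≤n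
χ-xor-─ false true  false s₂    = z≤n
χ-xor-─ false true  true  false = s≤s z≤n
χ-xor-─ false true  true  true  = z≤n
χ-xor-─ true  false false s₂    = ℕ.m≤n+m 1 (χ s₂)
χ-xor-─ true  false true  false = z≤n
χ-xor-─ true  false true  true  = s≤s z≤n
χ-xor-─ true  true  false s₂    = z≤n
χ-xor-─ true  true  true  false = s≤s z≤n
χ-xor-─ true  true  true  true  = z≤n

-- When the first end is in S and the second is in S or outside H, the left side is 0 and the right
-- side at least 2.
χ-xor-─-tight : ∀ {h₁ s₁ h₂ s₂} → χ ((h₁ ∧ not s₁) xor (h₂ ∧ not s₂)) ≡ χ s₁ + χ s₂ + χ (h₁ xor h₂) →
                h₁ ≡ true → s₁ ≡ true → h₂ ≡ true × s₂ ≡ false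
χ-xor-─-tight {true} {true} {true}  {false} _  _ _ = refl , refl
χ-xor-─-tight {true} {true} {true}  {true}  () _ _
χ-xor-─-tight {true} {true} {false} {s₂}    () _ _

χ-xor-─-tightʳ : ∀ {h₁ s₁ h₂ s₂} → χ ((h₁ ∧ not s₁) xor (h₂ ∧ not s₂)) ≡ χ s₁ + χ s₂ + χ (h₁ xor h₂) →
                 h₂ ≡ true → s₂ ≡ true → h₁ ≡ true × s₁ ≡ false
χ-xor-─-tightʳ {true}  {false} {true} {true} _  _ _ = refl , refl
χ-xor-─-tightʳ {true}  {true}  {true} {true} () _ _
χ-xor-─-tightʳ {false} {false} {true} {true} () _ _
χ-xor-─-tightʳ {false} {true}  {true} {true} () _ _

IsOddBarrier : {G : Graph} → Subgraph G → Graph.VertexSet G → Set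
IsOddBarrier H S =
  S ⊆ V H ×
  Independent H S ×
  (∀ v → v ∈ S → degree H v ≡ 3) ×
  (∀ L → IsComponent (H ∖ S) L → HasOddOrder L) ×
  NumberOfSubgraphs (λ L → IsComponent (H ∖ S) L × HasOddOrder L) (∣ S ∣ + 2) ×
  (∀ L → IsComponent (H ∖ S) L → ∣ δ L ∣ ≡ 3)

module BarrierComponents
  {G : Graph} (bridgeless : Bridgeless G) (cubic : Cubic G)
  (H : Subgraph G) (induced : IsInduced H) (∣δH∣≡6 : ∣ δ H ∣ ≡ 6)
  {S : Graph.VertexSet G} {d : ℕ} (2≤d : 2 ≤ d)
  (isBarrier : GraphMatching.Barrier G (V H) S d) where

  open Graph G
  open GraphMatching G
  open Barrier isBarrier
  open Extremal bound

  K : Subgraph G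
  K = H ∖ S

  C : Vertex → Subgraph G
  C = component K

  K-induced : IsInduced K
  K-induced e s∈ t∈ = x∈p∧x∉q⇒x∈p─q (induced e (p─q⊆p _ _ s∈) (p─q⊆p _ _ t∈)) λ e∈ →
    contradiction (trans (sym ([]=⇒lookup e∈)) (trans (lookup∘tabulate _ e)
      (cong₂ _∨_ (lookup-∉ (x∈p─q⇒x∉q s∈)) (lookup-∉ (x∈p─q⇒x∉q t∈))))) λ ()

  C⊆K : ∀ {v} → v ∈ V K → V (C v) ⊆ V K
  C⊆K {v} v∈ = proj₁ (component-⊑ K v v∈)

  joined-component : ∀ {v x y} → Adj x y → x ∈ V K → y ∈ V K → x ∈ V (C v) → y ∈ V (C v)
  joined-component {v} (e , inj₁ (refl , refl)) s∈ t∈ = proj₁ (component-closed K v e (K-induced e s∈ t∈))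
  joined-component {v} (e , inj₂ (refl , refl)) t∈ s∈ = proj₂ (component-closed K v e (K-induced e s∈ t∈))

  -- Gallai's lemma: adjacent vertices are related by `maximum-augment`, and `≈-trans` carries this
  -- along a walk.
  linked⇒≈ : ∀ {u v} → u ∈ V K → Linked K u v → u ≈ v
  linked⇒≈ u∈ ε _ _ _ _ = refl
  linked⇒≈ {u} {v} u∈ (_◅_ {j = t} (e , e∈ , joins) l) =
    ≈-trans missable u∈ t∈ (Linked-∈ K l t∈)
      (λ m Mm mu mt → maximum-augment Mm u∈ t∈ mu mt (e , joins))
      (linked⇒≈ t∈ l)
    where
    t∈ : t ∈ V K
    t∈ = Linked-∈ K ((e , e∈ , joins) ◅ ε) u∈

  same-component⇒≈ : ∀ {u v w} → u ∈ V K → w ∈ V (C u) → w ∈ V (C v) → u ≈ v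
  same-component⇒≈ {u} {v} u∈ w∈u w∈v =
    linked⇒≈ u∈ (component-linked K u w∈u ◅◅ Linked-sym K (component-linked K v w∈v))

  parity-fixed-component : ∀ {v m} → v ∈ V K → IsMatchingOn (V K) m →
                           parity ∣ V (C v) ∩ fixed (lookup m) ∣ ≡ parity ∣ V (C v) ∣
  parity-fixed-component {v} {m} v∈ M = parity-fixed (V (C v)) (invol M) stays
    where
    stays : ∀ {w} → w ∈ V (C v) → lookup m w ∈ V (C v)
    stays {w} w∈ with lookup m w ≟ w
    ... | yes mw≡w = subst (_∈ V (C v)) (sym mw≡w) w∈
    ... | no mw≢w  = joined-component {v} (proj₂ (edge M w mw≢w)) (C⊆K v∈ w∈) (mate∈ M mw≢w) w∈

  -- A maximum matching that misses v misses no other vertex of `C v`, and it pairs up the remaining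
  -- ones within `C v`.
  component-odd : ∀ {v} → v ∈ V K → parity ∣ V (C v) ∣ ≡ 1ℙ
  component-odd {v} v∈ with missable v v∈
  ... | m , Mm@(M , _) , mv = trans (sym (parity-fixed-component v∈ M))
    (cong parity (trans (cong ∣_∣ only-v) (∣⁅x⁆∣≡1 v)))
    where
    fixed? = λ w → lookup m w ≟ w
    only-v : V (C v) ∩ fixed (lookup m) ≡ ⁅ v ⁆
    only-v = ⊆-antisym
      (λ w∈ → let (w∈C , w∈F) = x∈p∩q⁻ (V (C v)) _ w∈ in
        subst (_∈ ⁅ v ⁆) (linked⇒≈ v∈ (component-linked K v w∈C) m Mm mv (∈⟦⟧⁻ fixed? w∈F)) (x∈⁅x⁆ v))
      (λ w∈ → subst (_∈ V (C v) ∩ fixed (lookup m)) (sym (x∈⁅y⁆⇒x≡y v w∈))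
        (x∈p∩q⁺ (∈component K v , ∈⟦⟧⁺ fixed? mv)))

  abstract
    -- `missable` needs a vertex to start from. The empty matching misses at least |S| + d ≥ 2
    -- vertices, so there is one.
    maximum : ∃ IsMaximum
    maximum = let (v , v∈) = nonempty
                  (m , Mm , _) = missable v (proj₁ (∈missed⁻ (tabulate id) v∈))
              in m , Mm
      where
      nonempty : Nonempty (missed (V K) (tabulate id))
      nonempty = ∣p∣≢0⇒Nonempty (ℕ.m<n⇒n≢0
        (ℕ.≤-trans 2≤d (ℕ.≤-trans (ℕ.m≤n+m d ∣ S ∣) (bound _ (trivial (V K))))))

  m : Vec Vertex nV
  m = proj₁ maximum

  M : IsMatchingOn (V K) m
  M = proj₁ (proj₂ maximum)

  -- The vertices missed by one maximum matching index the components: at most one lies in each by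
  -- `≈`, at least one because an odd component cannot be paired up completely.
  reps : VertexSet
  reps = missed (V K) m

  ∣reps∣ : ∣ reps ∣ ≡ ∣ S ∣ + d
  ∣reps∣ = proj₂ (proj₂ maximum)

  reps⊆K : reps ⊆ V K
  reps⊆K u∈ = proj₁ (∈missed⁻ m u∈)

  reps-unique : ∀ {u v w} → u ∈ reps → v ∈ reps → w ∈ V (C u) → w ∈ V (C v) → u ≡ v
  reps-unique u∈ v∈ w∈u w∈v = same-component⇒≈ (reps⊆K u∈) w∈u w∈v m (proj₂ maximum)
    (proj₂ (∈missed⁻ m u∈)) (proj₂ (∈missed⁻ m v∈))

  representative : ∀ L → IsComponent K L → ∃ λ v → v ∈ reps × L ≡ C v
  representative L comp@((( u , u∈L) , _) , L⊑K , _) =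
    v , ∈missed⁺ m v∈K (∈⟦⟧⁻ (λ w → lookup m w ≟ w) (proj₂ v∈′)) ,
    isComponent⇒≡component K v L comp (subst (λ L → v ∈ V L) (sym L≡Cu) (proj₁ v∈′))
    where
    u∈K = proj₁ L⊑K u∈L
    L≡Cu = isComponent⇒≡component K u L comp u∈L
    hit : Nonempty (V (C u) ∩ fixed (lookup m))
    hit = ∣p∣≢0⇒Nonempty λ ∣p∣≡0 → contradiction
      (trans (sym (cong parity ∣p∣≡0)) (trans (parity-fixed-component u∈K M) (component-odd u∈K))) λ ()
    v = proj₁ hit
    v∈′ = x∈p∩q⁻ (V (C u)) _ (proj₂ hit)
    v∈K = C⊆K u∈K (proj₁ v∈′)

  leaves : Vertex → Edge → Bool
  leaves v e = lookup reps v ∧ lookup (δ (C v)) e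

  -- K is induced, so an edge leaving a component leaves K altogether; its only end in K lies in a
  -- single component.
  ∑leaves≤δK : ∀ e → ∑[ v < nV ] χ (leaves v e) ≤ χ (lookup (δ K) e)
  ∑leaves≤δK e = ℕ.≤-trans (ℕ.≤-reflexive (sym (∣tabulate∣≡∑χ λ v → leaves v e))) bounded
    where
    L : VertexSet
    L = tabulate λ v → leaves v e

    split : ∀ {v} → v ∈ L → v ∈ reps × e ∈ δ (C v)
    split {v} v∈ with lookup reps v in eq₁ | lookup (δ (C v)) e in eq₂
                    | trans (sym (lookup∘tabulate (λ v → leaves v e) v)) ([]=⇒lookup v∈)
    ... | true  | true  | _ = lookup⇒[]= v _ eq₁ , lookup⇒[]= e _ eq₂
    ... | true  | false | ()
    ... | false | _     | ()

    inside-outside : ∀ {v} → v ∈ L →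
      (src e ∈ V (C v) × tgt e ∉ V K) ⊎ (src e ∉ V K × tgt e ∈ V (C v))
    inside-outside {v} v∈ with split v∈
    ... | v∈reps , e∈δ with ∈δ⁻ (C v) e∈δ
    ...   | inj₁ (s∈ , t∉) = inj₁ (s∈ , λ t∈ →
      t∉ (joined-component {v} (e , inj₁ (refl , refl)) (C⊆K (reps⊆K v∈reps) s∈) t∈ s∈))
    ...   | inj₂ (s∉ , t∈) = inj₂ ((λ s∈ →
      s∉ (joined-component {v} (e , inj₂ (refl , refl)) (C⊆K (reps⊆K v∈reps) t∈) s∈ t∈)) , t∈)

    unique : ∀ {u v} → u ∈ L → v ∈ L → u ≡ v
    unique {u} {v} u∈ v∈ with split u∈ | split v∈ | inside-outside u∈ | inside-outside v∈
    ... | u∈r , _ | v∈r , _ | inj₁ (s∈u , _) | inj₁ (s∈v , _) = reps-unique u∈r v∈r s∈u s∈v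
    ... | u∈r , _ | v∈r , _ | inj₂ (_ , t∈u) | inj₂ (_ , t∈v) = reps-unique u∈r v∈r t∈u t∈v
    ... | u∈r , _ | _       | inj₁ (s∈u , _) | inj₂ (s∉ , _)  = contradiction (C⊆K (reps⊆K u∈r) s∈u) s∉
    ... | _       | v∈r , _ | inj₂ (s∉ , _)  | inj₁ (s∈v , _) = contradiction (C⊆K (reps⊆K v∈r) s∈v) s∉

    bounded : ∣ L ∣ ≤ χ (lookup (δ K) e)
    bounded with nonempty? L
    ... | no empty = subst (_≤ _) (sym (Empty⇒∣p∣≡0 empty)) z≤n
    ... | yes (v , v∈) = ℕ.≤-trans (∣p∣≤1 unique) (ℕ.≤-reflexive (sym (cong χ e∈δK)))
      where
      v∈K = reps⊆K (proj₁ (split v∈))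
      e∈δK : lookup (δ K) e ≡ true
      e∈δK = trans (lookup∘tabulate _ e) (go (inside-outside v∈))
        where
        go : (src e ∈ V (C v) × tgt e ∉ V K) ⊎ (src e ∉ V K × tgt e ∈ V (C v)) →
             (lookup (V K) (src e) xor lookup (V K) (tgt e)) ≡ true
        go (inj₁ (s∈ , t∉)) = cong₂ _xor_ ([]=⇒lookup (C⊆K v∈K s∈)) (lookup-∉ t∉)
        go (inj₂ (s∉ , t∈)) = cong₂ _xor_ (lookup-∉ s∉) ([]=⇒lookup (C⊆K v∈K t∈))

  -- The units of capacity of e. They total 3|S| + 6, kept in the form (|S| + 2) * 3 for comparison
  -- with the demand (|S| + d) * 3.
  available : Edge → ℕ
  available e = χ (lookup S (src e)) + χ (lookup S (tgt e)) +
                χ (lookup (V H) (src e) xor lookup (V H) (tgt e))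

  δK-bits : ∀ e → lookup (δ K) e ≡
    ((lookup (V H) (src e) ∧ not (lookup S (src e))) xor (lookup (V H) (tgt e) ∧ not (lookup S (tgt e))))
  δK-bits e = trans (lookup∘tabulate _ e) (cong₂ _xor_ (lookup-─ (V H) S (src e)) (lookup-─ (V H) S (tgt e)))

  δK≤available : ∀ e → χ (lookup (δ K) e) ≤ available e
  δK≤available e = subst (λ b → χ b ≤ available e) (sym (δK-bits e))
    (χ-xor-─ (lookup (V H) (src e)) (lookup S (src e)) _ _)

  ∑available : sum available ≡ (∣ S ∣ + 2) * 3
  ∑available = begin
    sum available            ≡⟨ ∑-distrib-+ ends leaving ⟩
    sum ends + sum leaving   ≡⟨ cong₂ _+_ (handshake {G} cubic S) (∣tabulate∣≡∑χ leaves-H) ⟨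
    ∣ S ∣ * 3 + ∣ δ H ∣      ≡⟨ cong (∣ S ∣ * 3 +_) ∣δH∣≡6 ⟩
    ∣ S ∣ * 3 + 2 * 3        ≡⟨ ℕ.*-distribʳ-+ 3 ∣ S ∣ 2 ⟨
    (∣ S ∣ + 2) * 3          ∎
    where
    open ≡-Reasoning
    leaves-H : Edge → Bool
    leaves-H e = lookup (V H) (src e) xor lookup (V H) (tgt e)
    ends leaving : Edge → ℕ
    ends e = χ (lookup S (src e)) + χ (lookup S (tgt e))
    leaving e = χ (leaves-H e)

  needed supplied : Vertex → ℕ
  needed v   = χ (lookup reps v) * 3
  supplied v = χ (lookup reps v) * ∣ δ (C v) ∣

  ∑needed : sum needed ≡ (∣ S ∣ + d) * 3
  ∑needed = begin
    sum needed                              ≡⟨ *-distribʳ-sum 3 (λ v → χ (lookup reps v)) ⟨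
    (∑[ v < nV ] χ (lookup reps v)) * 3     ≡⟨ cong (_* 3) (∣p∣≡∑χ reps) ⟨
    ∣ reps ∣ * 3                            ≡⟨ cong (_* 3) ∣reps∣ ⟩
    (∣ S ∣ + d) * 3                         ∎
    where open ≡-Reasoning

  needed≤supplied : ∀ v → needed v ≤ supplied v
  needed≤supplied v with v ∈? reps
  ... | yes v∈ = ℕ.*-monoʳ-≤ (χ (lookup reps v))
    (odd⇒∣δ∣≥3 bridgeless cubic (C v) (component-odd (reps⊆K v∈)))
  ... | no v∉ rewrite lookup-∉ v∉ = z≤n

  ∑supplied : sum supplied ≡ ∑[ e < nE ] ∑[ v < nV ] χ (leaves v e)
  ∑supplied = begin
    sum supplied
      ≡⟨ sum-cong-≗ (λ v → trans (cong (χ (lookup reps v) *_) (∣p∣≡∑χ (δ (C v))))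
                                 (*-distribˡ-sum (χ (lookup reps v)) (λ e → χ (lookup (δ (C v)) e)))) ⟩
    ∑[ v < nV ] ∑[ e < nE ] (χ (lookup reps v) * χ (lookup (δ (C v)) e))
      ≡⟨ sum-cong-≗ (λ v → sum-cong-≗ λ e → sym (χ-∧ (lookup reps v) (lookup (δ (C v)) e))) ⟩
    ∑[ v < nV ] ∑[ e < nE ] χ (leaves v e)
      ≡⟨ ∑-comm (λ v e → χ (leaves v e)) ⟩
    ∑[ e < nE ] ∑[ v < nV ] χ (leaves v e)
      ∎
    where open ≡-Reasoning

  ∑supplied≤∑δK : sum supplied ≤ ∑[ e < nE ] χ (lookup (δ K) e)
  ∑supplied≤∑δK = ℕ.≤-trans (ℕ.≤-reflexive ∑supplied) (sum-mono ∑leaves≤δK)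

  -- This closes the cycle from `sum needed` through `sum supplied`, the size of δ K and
  -- `sum available` back to `sum needed`, so all four agree.
  ∑available≤∑needed : sum available ≤ sum needed
  ∑available≤∑needed = subst₂ _≤_ (sym ∑available) (sym ∑needed) (ℕ.*-monoˡ-≤ 3 (ℕ.+-monoʳ-≤ ∣ S ∣ 2≤d))

  δK≡available : ∀ e → χ (lookup (δ K) e) ≡ available e
  δK≡available = sum-squeeze δK≤available
    (ℕ.≤-trans ∑available≤∑needed (ℕ.≤-trans (sum-mono needed≤supplied) ∑supplied≤∑δK))

  needed≡supplied : ∀ v → needed v ≡ supplied v
  needed≡supplied = sum-squeeze needed≤supplied
    (ℕ.≤-trans ∑supplied≤∑δK (ℕ.≤-trans (sum-mono δK≤available) ∑available≤∑needed))

  ∣reps∣≡∣S∣+2 : ∣ reps ∣ ≡ ∣ S ∣ + 2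
  ∣reps∣≡∣S∣+2 = trans ∣reps∣ (ℕ.*-cancelʳ-≡ _ _ 3 (trans (sym ∑needed) (trans
    (ℕ.≤-antisym (ℕ.≤-trans (sum-mono needed≤supplied) (ℕ.≤-trans ∑supplied≤∑δK (sum-mono δK≤available)))
                 ∑available≤∑needed) ∑available)))

  ∣δC∣≡3 : ∀ {v} → v ∈ reps → ∣ δ (C v) ∣ ≡ 3
  ∣δC∣≡3 {v} v∈ with needed≡supplied v
  ... | eq rewrite []=⇒lookup v∈ = trans (sym (ℕ.+-identityʳ _)) (sym eq)

  private
    tight : ∀ e → _
    tight e = trans (cong χ (sym (δK-bits e))) (δK≡available e)

  neighbour-of-S : ∀ {e u v} → Joins e u v → u ∈ S → v ∈ V H × v ∉ S
  neighbour-of-S {e} (inj₁ (refl , refl)) u∈S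
    with χ-xor-─-tight {lookup (V H) (src e)} (tight e) ([]=⇒lookup (S⊆X u∈S)) ([]=⇒lookup u∈S)
  ... | v∈H , v∉S = lookup⇒[]= _ _ v∈H , λ v∈S → contradiction (trans (sym ([]=⇒lookup v∈S)) v∉S) λ ()
  neighbour-of-S {e} (inj₂ (refl , refl)) u∈S
    with χ-xor-─-tightʳ {lookup (V H) (src e)} (tight e) ([]=⇒lookup (S⊆X u∈S)) ([]=⇒lookup u∈S)
  ... | v∈H , v∉S = lookup⇒[]= _ _ v∈H , λ v∈S → contradiction (trans (sym ([]=⇒lookup v∈S)) v∉S) λ ()

  independent : Independent H S
  independent e _ (s∈ , t∈) = proj₂ (neighbour-of-S (inj₁ (refl , refl)) s∈) t∈

  degree-S : ∀ v → v ∈ S → degree H v ≡ 3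
  degree-S v v∈ = trans (cong₂ (λ p q → ∣ p ∣ + ∣ q ∣)
      (all-in-H src λ e → λ { refl → induced e (S⊆X v∈) (proj₁ (neighbour-of-S (inj₁ (refl , refl)) v∈)) })
      (all-in-H tgt λ e → λ { refl → induced e (proj₁ (neighbour-of-S (inj₂ (refl , refl)) v∈)) (S⊆X v∈) }))
    (cubic v)
    where
    all-in-H : (end : Edge → Vertex) → (∀ e → end e ≡ v → e ∈ E H) →
               E H ∩ ⟦ (λ e → end e ≟ v) ⟧ ≡ ⊤ ∩ ⟦ (λ e → end e ≟ v) ⟧
    all-in-H end at-v = ⊆-antisym
      (λ e∈ → x∈p∩q⁺ (∈⊤ , proj₂ (x∈p∩q⁻ (E H) _ e∈)))
      (λ {e} e∈ → let e∈v = proj₂ (x∈p∩q⁻ ⊤ _ e∈) in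
        x∈p∩q⁺ (at-v e (∈⟦⟧⁻ (λ e → end e ≟ v) e∈v) , e∈v))

  odd-order : ∀ L → IsComponent K L → HasOddOrder L
  odd-order L comp = let (v , v∈ , L≡Cv) = representative L comp in
    parity≡1⇒odd ∣ V L ∣ (subst (λ L → parity ∣ V L ∣ ≡ 1ℙ) (sym L≡Cv) (component-odd (reps⊆K v∈)))

  ∣δL∣≡3 : ∀ L → IsComponent K L → ∣ δ L ∣ ≡ 3
  ∣δL∣≡3 L comp = let (v , v∈ , L≡Cv) = representative L comp in
    subst (λ L → ∣ δ L ∣ ≡ 3) (sym L≡Cv) (∣δC∣≡3 v∈)

  number-of-components : NumberOfSubgraphs (λ L → IsComponent K L × HasOddOrder L) (∣ S ∣ + 2)
  number-of-components = List.map C repList ,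
    unique-map C C-injective (filter⁺ (_∈? reps) (allFin⁺ nV)) ,
    (λ L → mk⇔ (to L) (from L)) ,
    trans (length-map C repList) (trans (length-filter-tabulate (_∈? reps) id)
      (trans (cong ∣_∣ (⟦∈?⟧ reps)) ∣reps∣≡∣S∣+2))
    where
    repList : List Vertex
    repList = filter (_∈? reps) (allFin nV)

    ∈reps : ∀ {v} → v ∈ₗ repList → v ∈ reps
    ∈reps v∈ = proj₂ (∈-filter⁻ (_∈? reps) {xs = allFin nV} v∈)

    C-injective : ∀ {u v} → u ∈ₗ repList → v ∈ₗ repList → C u ≡ C v → u ≡ v
    C-injective {u} u∈ v∈ Cu≡Cv = reps-unique (∈reps u∈) (∈reps v∈) (∈component K u)
      (subst (λ L → u ∈ V L) Cu≡Cv (∈component K u))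

    to : ∀ L → L ∈ₗ List.map C repList → IsComponent K L × HasOddOrder L
    to L L∈ = let (v , v∈ , L≡Cv) = ∈-map⁻ C L∈
                  comp = subst (IsComponent K) (sym L≡Cv) (component-isComponent K v (reps⊆K (∈reps v∈)))
              in comp , odd-order L comp

    from : ∀ L → IsComponent K L × HasOddOrder L → L ∈ₗ List.map C repList
    from L (comp , _) = let (v , v∈ , L≡Cv) = representative L comp in
      subst (_∈ₗ List.map C repList) (sym L≡Cv) (∈-map⁺ C (∈-filter⁺ (_∈? reps) (∈-allFin v) v∈))

  isOddBarrier : IsOddBarrier H S
  isOddBarrier = S⊆X , independent , degree-S , odd-order , number-of-components , ∣δL∣≡3

theorem4p1 : (G : Graph) → Bridgeless G → Cubic G →
    (H : Subgraph G) → IsInduced H → ∣ δ H ∣ ≡ 6 →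
    HasPerfectMatching H ⊎
    (∃ λ (S : Graph.VertexSet G) →
    S ⊆ V H ×
    Independent H S ×
    (∀ v → v ∈ S → degree H v ≡ 3) ×
    (∀ L → IsComponent (H ∖ S) L → HasOddOrder L) ×
    NumberOfSubgraphs (λ L → IsComponent (H ∖ S) L × HasOddOrder L) (∣ S ∣ + 2) ×
    (∀ L → IsComponent (H ∖ S) L → ∣ δ L ∣ ≡ 3))
theorem4p1 G bridgeless cubic H induced ∣δH∣≡6 = byDeficiency _ refl
  where
  open GraphMatching G

  optimal = argmin (isMatchingOn? (V H)) (λ m → ∣ missed (V H) m ∣) (tabulate id , trivial (V H))

  m = proj₁ optimal

  M : IsMatchingOn (V H) m
  M = proj₁ (proj₂ optimal)

  even-order : parity ∣ V H ∣ ≡ 0ℙ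
  even-order = trans (sym (parity-∣δ∣ cubic H)) (cong parity ∣δH∣≡6)

  byDeficiency : ∀ d → ∣ missed (V H) m ∣ ≡ d → HasPerfectMatching H ⊎ ∃ (IsOddBarrier H)
  byDeficiency 0 eq = inj₁ (perfectMatching H induced M eq)
  -- The order of H is even because |δ H| = 6 is, and the number of missed vertices has the same
  -- parity.
  byDeficiency 1 eq = contradiction
    (trans (sym even-order) (trans (sym (parity-missed M)) (cong parity eq))) λ ()
  byDeficiency d@(suc (suc _)) eq =
    let (S , isBarrier) = barrier (V H) d
          (λ m′ M′ → ℕ.≤-trans (ℕ.≤-reflexive (sym eq)) (proj₂ (proj₂ optimal) m′ M′))
          (trans (sym (parity-missed M)) (cong parity eq))
    in inj₂ (S , BarrierComponents.isOddBarrier bridgeless cubic H induced ∣δH∣≡6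
                   (s≤s (s≤s z≤n)) isBarrier)
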